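{- Let $r\ge1$ and write $r=2s+\epsilon$ with $\epsilon\in\{0,1\}$. Then $$P_{r+1}(\{a\})=\Big(\prod_{i=1-\epsilon}^{s}U_{2i+\epsilon}\big(1,1,(-1)^{\epsilon+1}a_{2(s-i)+1}\big)\Big)\,P\,\Big(\prod_{i=1}^{s}U_{2i}(1,1,a_{2i})\Big),$$ where the factors within each product commute.
   Context: For $i\in[1,r]$ and nonzero $a,b,c$, $U_i(a,b,c)$ (resp. $V_i(a,b,c)$) is the $(r+1)\times(r+1)$ identity matrix except that its block in rows/columns $i,i+1$ is $\begin{pmatrix}1&0\\ c/b& a/b\end{pmatrix}$ (resp. $\begin{pmatrix}b/c& a/c\\ 0&1\end{pmatrix}$). $P$ is the $(r+1)\times(r+1)$ matrix with entries $P_{i,j}=(-1)^{(r-1)(i-1)}\delta_{i+j,r+2}$. With $a_1,\dots,a_r$ indeterminates, the array $(a_{i,-j})_{i,j\in[0,r+1]}$ is defined by $a_{i,0}=1$, $a_{0,-j}=a_{r+1,-j}=1$, $a_{i,-1}=a_i$ ($i\in[1,r]$), and $a_{i-1,-j}a_{i+1,-j}+a_{i,-j-1}a_{i,-j+1}=0$ for $i,j\in[1,r]$. For $i\in[1,r]$, $k\in[-r,0]$: $N_{i,k}(\{a\})=U_i(a_{i,k-1},a_{i,k},a_{i+1,k-1})$ if $i+k$ odd, $N_{i,k}(\{a\})=V_i(a_{i-1,k},a_{i,k-1},a_{i,k})$ if $i+k$ even. Finally $P_{r+1}(\{a\})=\prod_{k=-r}^{0}\big(N_{1,k}(\{a\})\cdots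 N_{r,k}(\{a\})\big)$ with factors ordered left to right by increasing $k$. -}

module Defs where

open import Level using (Level; _⊔_) renaming (suc to lsuc)
open import Algebra.Bundles using (CommutativeRing)
open import Data.Nat using (ℕ; zero; suc; _∸_; _≡ᵇ_; _≤ᵇ_)
import Data.Nat as ℕ
open import Data.Fin using (Fin; toℕ)
import Data.Fin as Fin
open import Data.Bool using (Bool; true; false; if_then_else_; _∧_; _∨_; not)
open import Data.List using (List; []; _∷_; foldr; map; upTo; downFrom)
open import Data.List.Membership.Propositional using (_∈_)
open import Data.Product using (_×_; _,_; proj₁; proj₂)
open import Relation.Nullary using (¬_)

record Field (c ℓ : Level) : Set (lsuc (c ⊔ ℓ)) where
  field
    commutativeRing : CommutativeRing c ℓ
  open CommutativeRing commutativeRing public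
  field
    _⁻¹       : Carrier → Carrier
    ⁻¹-inverse : ∀ x → ¬ (x ≈ 0#) → x * (x ⁻¹) ≈ 1#
    1≉0       : ¬ (1# ≈ 0#)

module _ {c ℓ : Level} (F : Field c ℓ) where
  open Field F

  _/_ : Carrier → Carrier → Carrier
  x / y = x * (y ⁻¹)

  neg1^ : ℕ → Carrier
  neg1^ zero    = 1#
  neg1^ (suc n) = - (neg1^ n)

  -- square matrices of size n, entries indexed by Fin n (0-based);
  -- the paper's 1-based index of p : Fin n is suc (toℕ p).
  Mat : ℕ → Set c
  Mat n = Fin n → Fin n → Carrier

  ∑ : ∀ {n} → (Fin n → Carrier) → Carrier
  ∑ {zero}  f = 0#
  ∑ {suc n} f = f Fin.zero + ∑ (λ k → f (Fin.suc k))

  _·_ : ∀ {n} → Mat n → Mat n → Mat n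
  (A · B) i j = ∑ (λ k → A i k * B k j)

  Id : ∀ {n} → Mat n
  Id i j = if toℕ i ≡ᵇ toℕ j then 1# else 0#

  _≋_ : ∀ {n} → Mat n → Mat n → Set ℓ
  A ≋ B = ∀ i j → A i j ≈ B i j

  prodM : ∀ {n} → List (Mat n) → Mat n
  prodM = foldr _·_ Id

  PairwiseCommute : ∀ {n} → List (Mat n) → Set (c ⊔ ℓ)
  PairwiseCommute L = ∀ {X Y} → X ∈ L → Y ∈ L → (X · Y) ≋ (Y · X)

  U : (r i : ℕ) → Carrier → Carrier → Carrier → Mat (suc r)
  U r i a b c' p q =
    let P = suc (toℕ p) ; Q = suc (toℕ q) in
    if (P ≡ᵇ suc i) ∧ (Q ≡ᵇ i) then c' / b
    else if (P ≡ᵇ suc i) ∧ (Q ≡ᵇ suc i) then a / b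
    else if P ≡ᵇ Q then 1# else 0#

  V : (r i : ℕ) → Carrier → Carrier → Carrier → Mat (suc r)
  V r i a b c' p q =
    let P = suc (toℕ p) ; Q = suc (toℕ q) in
    if (P ≡ᵇ i) ∧ (Q ≡ᵇ i) then b / c'
    else if (P ≡ᵇ i) ∧ (Q ≡ᵇ suc i) then a / c'
    else if (P ≡ᵇ suc i) ∧ (Q ≡ᵇ i) then 0#
    else if P ≡ᵇ Q then 1# else 0#

  Pmat : (r : ℕ) → Mat (suc r)
  Pmat r p q =
    let P = suc (toℕ p) ; Q = suc (toℕ q) in
    if P ℕ.+ Q ≡ᵇ r ℕ.+ 2 then neg1^ ((r ∸ 1) ℕ.* (P ∸ 1)) else 0#

  -- The array a_{i,-j}: rows r a j = (row j , row (j+1)), where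
  -- row j i = a_{i,-j}.  Row 0 is all 1; row 1 is a_i (with boundary 1);
  -- a_{i,-j-1} = - a_{i-1,-j} a_{i+1,-j} / a_{i,-j+1}   for i ∈ [1,r].
  -- Boundary: a_{0,-j} = a_{r+1,-j} = 1 (entries with i > r+1 are unused).
  boundary : ℕ → ℕ → Bool
  boundary r i = (i ≡ᵇ 0) ∨ (suc r ≤ᵇ i)

  rows : (r : ℕ) → (ℕ → Carrier) → ℕ → (ℕ → Carrier) × (ℕ → Carrier)
  rows r a zero = (λ _ → 1#) , (λ i → if boundary r i then 1# else a i)
  rows r a (suc j) =
    let R0 = proj₁ (rows r a j) ; R1 = proj₂ (rows r a j) in
    R1 , (λ i → if boundary r i then 1#
                else - ((R1 (i ∸ 1) * R1 (suc i)) / R0 i))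

  -- arr r a i j = a_{i,-j}
  arr : (r : ℕ) → (ℕ → Carrier) → ℕ → ℕ → Carrier
  arr r a i j = proj₁ (rows r a j) i

  odd : ℕ → Bool
  odd zero    = false
  odd (suc n) = not (odd n)

  -- N_{i,k} with k = -m
  N : (r : ℕ) → (ℕ → Carrier) → (i m : ℕ) → Mat (suc r)
  N r a i m =
    if odd (i ℕ.+ m)
    then U r i (arr r a i (suc m)) (arr r a i m) (arr r a (suc i) (suc m))
    else V r i (arr r a (i ∸ 1) m) (arr r a i (suc m)) (arr r a i m)

  -- P_{r+1}({a}) = ∏_{k=-r}^{0} (N_{1,k} ⋯ N_{r,k}); k = -m, m = r, r-1, …, 0
  Prr : (r : ℕ) → (ℕ → Carrier) → Mat (suc r)
  Prr r a = prodM (map (λ m → prodM (map (λ t → N r a (suc t) m) (upTo r)))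
                       (downFrom (suc r)))

  leftFactors : (r s ε : ℕ) → (ℕ → Carrier) → List (Mat (suc r))
  leftFactors r s ε a =
    map (λ i → U r (2 ℕ.* i ℕ.+ ε) 1# 1# (neg1^ (ε ℕ.+ 1) * a (2 ℕ.* (s ∸ i) ℕ.+ 1)))
        (map (λ t → (1 ∸ ε) ℕ.+ t) (upTo (s ℕ.+ ε)))

  rightFactors : (r s : ℕ) → (ℕ → Carrier) → List (Mat (suc r))
  rightFactors r s a = map (λ i → U r (2 ℕ.* i) 1# 1# (a (2 ℕ.* i))) (map suc (upTo s))

{-# OPTIONS --safe #-}
-- Let P_{r+1} act on a column v, one block N_{1,-m} ⋯ N_{r,-m} at a time, and let W m be the
-- column after m blocks (m = 0, …, r+1).  Write α p m for a_{p,-m} and put W m 0 = W m (r+2) = 0.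
-- Block m replaces the entries in positions p with p + m even by
--     W (m+1) p = λ W m (p-1) + λ ρ W m p + ρ W m (p+1),
--     λ = α p (m+1) / α (p-1) m,   ρ = α (p-1) (m+1) / α p m,
-- and keeps the others.  The recurrence for α says that λ and ρ change sign along the two families
-- of diagonals, so this is a discrete wave equation whose left- and right-moving parts
--     (W m p - λ W m (p-1)) / α (p-1) m    and    (W m p - ρ W m (p+1)) / α p m
-- are constant along these diagonals.  Each part starts as v_{k+1} + a_k v_k (k even) or
-- v_k + a_k v_{k+1} (k odd) and is reflected once at the boundary; at time r+1 the two parts
-- together force W (r+1) p = (-1)^{r-1} v_q for p ≡ r (mod 2), q = r+2-p, and
-- W (r+1) (p+1) = v_{q-1} + a_{q-2} v_{q-2} + a_{q-1} v_q, which is the right-hand side.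
module Submission where

open import Defs
open import Level using (Level)
open import Data.Nat as ℕ using (ℕ; zero; suc; _≤_; _<_; z≤n; s≤s; _≡ᵇ_; _≤ᵇ_; _∸_)
import Data.Nat.Properties as ℕₚ
open import Data.Bool using (Bool; true; false; if_then_else_; _∧_; not; T; _xor_)
import Data.Bool.Properties as Boolₚ
open import Data.Empty using (⊥-elim)
open import Data.Unit using (tt)
open import Data.Fin as Fin using (Fin; toℕ)
import Data.Fin.Properties as Finₚ
open import Data.List using (List; []; _∷_; map; foldr; upTo; downFrom; applyUpTo)
open import Data.List.Properties using (map-upTo)
open import Data.List.Membership.Propositional using (_∈_)
open import Data.List.Membership.Propositional.Properties using (∈-map⁻; ∈-upTo⁻)
open import Data.Product using (_×_; _,_; proj₁; ∃)
open import Relation.Nullary using (¬_; yes; no)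
open import Relation.Binary.PropositionalEquality as ≡ using (_≡_; _≢_)

-- Boolean equality of natural numbers.

≡ᵇ-refl : ∀ n → (n ≡ᵇ n) ≡ true
≡ᵇ-refl zero    = ≡.refl
≡ᵇ-refl (suc n) = ≡ᵇ-refl n

≡ᵇ-sym : ∀ m n → (m ≡ᵇ n) ≡ (n ≡ᵇ m)
≡ᵇ-sym zero    zero    = ≡.refl
≡ᵇ-sym zero    (suc n) = ≡.refl
≡ᵇ-sym (suc m) zero    = ≡.refl
≡ᵇ-sym (suc m) (suc n) = ≡ᵇ-sym m n

≡ᵇ-true : ∀ {m n} → (m ≡ᵇ n) ≡ true → m ≡ n
≡ᵇ-true {m} {n} eq = ℕₚ.≡ᵇ⇒≡ m n (≡.subst T (≡.sym eq) tt)

≢⇒≡ᵇ : ∀ {m n} → m ≢ n → (m ≡ᵇ n) ≡ false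
≢⇒≡ᵇ {m} {n} m≢n with m ≡ᵇ n in eq
... | true  = ⊥-elim (m≢n (≡ᵇ-true eq))
... | false = ≡.refl

-- Matrices acting on columns; `U` and `V` as local updates of a zero-padded column.

module Action {c ℓ : Level} (F : Field c ℓ) where
  open Field F
  open import Relation.Binary.Reasoning.Setoid setoid
  open import Algebra.Solver.Ring.NaturalCoefficients.Default commutativeSemiring

  Seq : Set c
  Seq = ℕ → Carrier

  ∑-cong : ∀ n {f g : Fin n → Carrier} → (∀ k → f k ≈ g k) → ∑ F f ≈ ∑ F g
  ∑-cong zero    f≈g = refl
  ∑-cong (suc n) f≈g = +-cong (f≈g Fin.zero) (∑-cong n (λ k → f≈g (Fin.suc k)))

  ∑-zero : ∀ n → ∑ F {n} (λ _ → 0#) ≈ 0#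
  ∑-zero zero    = refl
  ∑-zero (suc n) = trans (+-identityˡ _) (∑-zero n)

  ∑-+ : ∀ n (f g : Fin n → Carrier) → ∑ F (λ k → f k + g k) ≈ ∑ F f + ∑ F g
  ∑-+ zero    f g = sym (+-identityˡ 0#)
  ∑-+ (suc n) f g = trans (+-congˡ (∑-+ n _ _))
    (solve 4 (λ a b x y → (a :+ b) :+ (x :+ y) := (a :+ x) :+ (b :+ y)) refl _ _ _ _)

  ∑-*ˡ : ∀ n x (f : Fin n → Carrier) → ∑ F (λ k → x * f k) ≈ x * ∑ F f
  ∑-*ˡ zero    x f = sym (zeroʳ x)
  ∑-*ˡ (suc n) x f = trans (+-congˡ (∑-*ˡ n x _)) (sym (distribˡ _ _ _))

  ∑-*ʳ : ∀ n x (f : Fin n → Carrier) → ∑ F (λ k → f k * x) ≈ ∑ F f * x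
  ∑-*ʳ n x f = trans (∑-cong n (λ k → *-comm (f k) x)) (trans (∑-*ˡ n x f) (*-comm x _))

  ∑-swap : ∀ m n (f : Fin m → Fin n → Carrier) →
    ∑ F (λ i → ∑ F (λ j → f i j)) ≈ ∑ F (λ j → ∑ F (λ i → f i j))
  ∑-swap zero    n f = sym (∑-zero n)
  ∑-swap (suc m) n f = trans (+-congˡ (∑-swap m n (λ i → f (Fin.suc i)))) (sym (∑-+ n _ _))

  infixr 6 _▹_
  _▹_ : ∀ {n} → Mat F n → (Fin n → Carrier) → (Fin n → Carrier)
  (A ▹ v) i = ∑ F (λ k → A i k * v k)

  ▹-cong : ∀ {n} (A : Mat F n) {v w : Fin n → Carrier} → (∀ k → v k ≈ w k) → ∀ i → (A ▹ v) i ≈ (A ▹ w) i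
  ▹-cong {n} A v≈w i = ∑-cong n (λ k → *-congˡ (v≈w k))

  ·-▹ : ∀ {n} (A B : Mat F n) v i → (_·_ F A B ▹ v) i ≈ (A ▹ B ▹ v) i
  ·-▹ {n} A B v i = begin
    ∑ F (λ k → ∑ F (λ l → A i l * B l k) * v k)   ≈⟨ ∑-cong n (λ k → sym (∑-*ʳ n (v k) _)) ⟩
    ∑ F (λ k → ∑ F (λ l → A i l * B l k * v k))   ≈⟨ ∑-swap n n _ ⟩
    ∑ F (λ l → ∑ F (λ k → A i l * B l k * v k))   ≈⟨ ∑-cong n (λ l → ∑-cong n (λ k → *-assoc _ _ _)) ⟩
    ∑ F (λ l → ∑ F (λ k → A i l * (B l k * v k))) ≈⟨ ∑-cong n (λ l → ∑-*ˡ n (A i l) _) ⟩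
    ∑ F (λ l → A i l * (B ▹ v) l)                 ∎

  -- Reading past the end gives `0#`; such zeros later serve as boundary values of the wave
  -- equation.
  at : ∀ {n} → (Fin n → Carrier) → Seq
  at {zero}  v _       = 0#
  at {suc n} v zero    = v Fin.zero
  at {suc n} v (suc k) = at (λ i → v (Fin.suc i)) k

  -- The entries v₁ , … , vₙ in the paper's 1-based indexing, extended by zero.
  pad : ∀ {n} → (Fin n → Carrier) → Seq
  pad v zero    = 0#
  pad v (suc k) = at v k

  at-toℕ : ∀ {n} (v : Fin n → Carrier) i → at v (toℕ i) ≡ v i
  at-toℕ v Fin.zero    = ≡.refl
  at-toℕ v (Fin.suc i) = at-toℕ (λ k → v (Fin.suc k)) i

  at-≥ : ∀ {n} (v : Fin n → Carrier) k → n ≤ k → at v k ≡ 0#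
  at-≥ {zero}  v k       _         = ≡.refl
  at-≥ {suc n} v (suc k) (s≤s n≤k) = at-≥ (λ i → v (Fin.suc i)) k n≤k

  -- `Fin n` reaches only the positions 1, ..., n; at position 0 and beyond n both sides are zero.
  pad-ext : ∀ {n} (v : Fin n → Carrier) (w : Seq) → w 0 ≈ 0# → (∀ k → n < k → w k ≈ 0#) →
    (∀ i → v i ≈ w (suc (toℕ i))) → ∀ p → pad v p ≈ w p
  pad-ext v w w0 w> v≈w zero    = sym w0
  pad-ext {n} v w w0 w> v≈w (suc k) with k ℕ.<? n
  ... | no k≮n = trans (reflexive (at-≥ v k (ℕₚ.≮⇒≥ k≮n))) (sym (w> (suc k) (s≤s (ℕₚ.≮⇒≥ k≮n))))
  ... | yes k<n = ≡.subst (λ k → at v k ≈ w (suc k)) (Finₚ.toℕ-fromℕ< k<n)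
          (trans (reflexive (at-toℕ v _)) (v≈w (Fin.fromℕ< k<n)))

  pad-> : ∀ {n} (v : Fin n → Carrier) k → n < k → pad v k ≈ 0#
  pad-> v (suc k) (s≤s n≤k) = reflexive (at-≥ v k n≤k)

  pad-cong : ∀ {n} {v w : Fin n → Carrier} → (∀ i → v i ≈ w i) → ∀ p → pad v p ≈ pad w p
  pad-cong {n} {v} {w} v≈w = pad-ext v (pad w) refl (pad-> w)
    (λ i → trans (v≈w i) (reflexive (≡.sym (at-toℕ w i))))

  pad-toℕ : ∀ {n} (v : Fin n → Carrier) i → v i ≈ pad v (suc (toℕ i))
  pad-toℕ v i = reflexive (≡.sym (at-toℕ v i))

  -- A matrix row with the single entry x in column i, columns being numbered from 1.
  δ : ℕ → Carrier → Seq
  δ i x q = if q ≡ᵇ i then x else 0#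

  ∑-δ : ∀ n i x (v : Fin n → Carrier) → ∑ F (λ k → δ i x (suc (toℕ k)) * v k) ≈ x * pad v i
  ∑-δ n zero x v = trans (∑-cong n (λ k → zeroˡ (v k))) (trans (∑-zero n) (sym (zeroʳ x)))
  ∑-δ zero    (suc i)       x v = sym (zeroʳ x)
  ∑-δ (suc n) (suc zero)    x v = begin
    x * v Fin.zero + ∑ F (λ k → 0# * v (Fin.suc k)) ≈⟨ +-congˡ (trans (∑-cong n (λ k → zeroˡ _)) (∑-zero n)) ⟩
    x * v Fin.zero + 0#                             ≈⟨ +-identityʳ _ ⟩
    x * v Fin.zero                                  ∎
  ∑-δ (suc n) (suc (suc i)) x v = begin
    0# * v Fin.zero + ∑ F (λ k → δ (suc i) x (suc (toℕ k)) * v (Fin.suc k))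
      ≈⟨ +-cong (zeroˡ _) (∑-δ n (suc i) x (λ k → v (Fin.suc k))) ⟩
    0# + x * at (λ k → v (Fin.suc k)) i
      ≈⟨ +-identityˡ _ ⟩
    x * at (λ k → v (Fin.suc k)) i ∎

  -- Serves the one row in which `U` or `V` differs from the identity: it has two adjacent entries.
  -- Columns start at 1, so `g` is tested at successors only.
  ∑-δ₂ : ∀ n i x y (g : Seq) (v : Fin n → Carrier) →
    (∀ q → g (suc q) ≈ δ i x (suc q) + δ (suc i) y (suc q)) →
    ∑ F (λ k → g (suc (toℕ k)) * v k) ≈ x * pad v i + y * pad v (suc i)
  ∑-δ₂ n i x y g v g≈ = begin
    ∑ F (λ k → g (suc (toℕ k)) * v k)
      ≈⟨ ∑-cong n (λ k → trans (*-congʳ (g≈ (toℕ k))) (distribʳ _ _ _)) ⟩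
    ∑ F (λ k → δ i x (suc (toℕ k)) * v k + δ (suc i) y (suc (toℕ k)) * v k)
      ≈⟨ ∑-+ n _ _ ⟩
    ∑ F (λ k → δ i x (suc (toℕ k)) * v k) + ∑ F (λ k → δ (suc i) y (suc (toℕ k)) * v k)
      ≈⟨ +-cong (∑-δ n i x v) (∑-δ n (suc i) y v) ⟩
    x * pad v i + y * pad v (suc i) ∎

  Id-▹ : ∀ {n} (v : Fin n → Carrier) p → (Id F ▹ v) p ≈ v p
  Id-▹ {n} v p = begin
    ∑ F (λ k → (if toℕ p ≡ᵇ toℕ k then 1# else 0#) * v k)
      ≈⟨ ∑-cong n (λ k → *-congʳ (reflexive (≡.cong (if_then 1# else 0#) (≡ᵇ-sym (toℕ p) (toℕ k))))) ⟩
    ∑ F (λ k → δ (suc (toℕ p)) 1# (suc (toℕ k)) * v k)    ≈⟨ ∑-δ n (suc (toℕ p)) 1# v ⟩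
    1# * at v (toℕ p)                                     ≈⟨ *-identityˡ _ ⟩
    at v (toℕ p)                                          ≈⟨ reflexive (at-toℕ v p) ⟩
    v p                                                   ∎

  prodM-▹ : ∀ {n} (As : List (Mat F n)) v i → (prodM F As ▹ v) i ≈ foldr _▹_ v As i
  prodM-▹ []       v i = Id-▹ v i
  prodM-▹ (A ∷ As) v i = trans (·-▹ A (prodM F As) v i) (▹-cong A (prodM-▹ As v) i)

  -- Of the entries i and i + 1 of a column, `U` overwrites the lower one (position i + 1) and `V`
  -- the upper one (position i).
  stepU stepV : ℕ → Carrier → Carrier → Seq → Seq
  stepU i x y w p = if p ≡ᵇ suc i then x * w i + y * w (suc i) else w p
  stepV i x y w p = if p ≡ᵇ i then x * w i + y * w (suc i) else w p

  -- Row i + 1 is the only row that is not a row of the identity, and i ≤ r keeps it inside the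
  -- matrix, so the padding stays zero.
  pad-U : ∀ r i a b d v → i ≤ r → ∀ p →
    pad (U F r i a b d ▹ v) p ≈ stepU i (_/_ F d b) (_/_ F a b) (pad v) p
  pad-U r i a b d v i≤r = pad-ext _ _ refl outside entry
    where
    x = _/_ F d b
    y = _/_ F a b
    outside : ∀ k → suc r < k → stepU i x y (pad v) k ≈ 0#
    outside k r<k rewrite ≢⇒≡ᵇ {k} {suc i} (λ { ≡.refl → ℕₚ.<⇒≱ r<k (s≤s i≤r) }) = pad-> v k r<k
    entry : ∀ p → (U F r i a b d ▹ v) p ≈ stepU i x y (pad v) (suc (toℕ p))
    entry p with toℕ p ≡ᵇ i in eq
    ... | false = trans (Id-▹ v p) (pad-toℕ v p)
    ... | true with ≡ᵇ-true {toℕ p} {i} eq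
    ... | ≡.refl = ∑-δ₂ (suc r) (toℕ p) x y rowU v row
      where
      rowU : Seq
      rowU q = if q ≡ᵇ toℕ p then x else if q ≡ᵇ suc (toℕ p) then y else if suc (toℕ p) ≡ᵇ q then 1# else 0#
      row : ∀ q → rowU (suc q) ≈ δ (toℕ p) x (suc q) + δ (suc (toℕ p)) y (suc q)
      row q with suc q ≡ᵇ toℕ p in e₁ | q ≡ᵇ toℕ p in e₂
      ... | true  | true  = ⊥-elim (ℕₚ.1+n≢n (≡.trans (≡ᵇ-true {suc q} e₁) (≡.sym (≡ᵇ-true {q} e₂))))
      ... | true  | false = sym (+-identityʳ x)
      ... | false | true  = sym (+-identityˡ y)
      ... | false | false rewrite ≡ᵇ-sym (toℕ p) q | e₂ = sym (+-identityˡ 0#)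

  pad-V : ∀ r i a b d v → i ≤ r → ∀ p →
    pad (V F r (suc i) a b d ▹ v) p ≈ stepV (suc i) (_/_ F b d) (_/_ F a d) (pad v) p
  pad-V r i a b d v i≤r = pad-ext _ _ refl outside entry
    where
    x = _/_ F b d
    y = _/_ F a d
    outside : ∀ k → suc r < k → stepV (suc i) x y (pad v) k ≈ 0#
    outside k r<k rewrite ≢⇒≡ᵇ {k} {suc i} (λ { ≡.refl → ℕₚ.<⇒≱ r<k (s≤s i≤r) }) = pad-> v k r<k
    entry : ∀ p → (V F r (suc i) a b d ▹ v) p ≈ stepV (suc i) x y (pad v) (suc (toℕ p))
    entry p with toℕ p ≡ᵇ i in eq
    ... | false = trans (∑-cong (suc r) (λ k → *-congʳ {v k} (row (toℕ k)))) (trans (Id-▹ v p) (pad-toℕ v p))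
      where
      -- The explicit zero in the definition of `V` lies off the diagonal, so it agrees with the
      -- identity.
      row : ∀ q → (if (toℕ p ≡ᵇ suc i) ∧ (q ≡ᵇ i) then 0# else if toℕ p ≡ᵇ q then 1# else 0#) ≈
          (if toℕ p ≡ᵇ q then 1# else 0#)
      row q with toℕ p ≡ᵇ suc i | q ≡ᵇ i in e
      ... | false | _     = refl
      ... | true  | false = refl
      ... | true  | true rewrite ≡ᵇ-true {q} e | eq = refl
    ... | true with ≡ᵇ-true {toℕ p} {i} eq
    ... | ≡.refl = ∑-δ₂ (suc r) (suc (toℕ p)) x y rowV v row
      where
      rowV : Seq
      rowV q = if q ≡ᵇ suc (toℕ p) then x else if q ≡ᵇ suc (suc (toℕ p)) then y else
        if (toℕ p ≡ᵇ suc (toℕ p)) ∧ (q ≡ᵇ suc (toℕ p)) then 0# else if suc (toℕ p) ≡ᵇ q then 1# else 0#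
      row : ∀ q → rowV (suc q) ≈ δ (suc (toℕ p)) x (suc q) + δ (suc (suc (toℕ p))) y (suc q)
      row q rewrite ≢⇒≡ᵇ {toℕ p} {suc (toℕ p)} (λ e → ℕₚ.1+n≢n (≡.sym e)) with q ≡ᵇ toℕ p in e₁ | q ≡ᵇ suc
          (toℕ p) in e₂
      ... | true  | true  = ⊥-elim (ℕₚ.1+n≢n (≡.trans (≡.sym (≡ᵇ-true {q} e₂)) (≡ᵇ-true {q} e₁)))
      ... | true  | false = sym (+-identityʳ x)
      ... | false | true  = sym (+-identityˡ y)
      ... | false | false rewrite ≡ᵇ-sym (toℕ p) q | e₁ = sym (+-identityˡ 0#)

-- Field identities, alternating signs and parity.

not-false : ∀ {b} → not b ≡ false → b ≡ true
not-false {true} _ = ≡.refl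

module FieldLemmas {c ℓ : Level} (F : Field c ℓ) where
  open Field F
  open import Algebra.Properties.Ring ring using (-‿distribˡ-*; -‿involutive)
  open import Algebra.Properties.AbelianGroup +-abelianGroup using () renaming
      (inverseˡ-unique to +-inverse-unique)
  open import Relation.Binary.Reasoning.Setoid setoid
  open import Algebra.Solver.Ring.NaturalCoefficients.Default commutativeSemiring

  σ : ℕ → Carrier
  σ = neg1^ F

  -- `true` stands for odd, so `parity n ≡ false` reads "n is even".
  parity : ℕ → Bool
  parity = odd F

  -- The defining relation of the array at i = p + 1, j = m + 1, in its division-free form.
  Recurrence : ℕ → (ℕ → ℕ → Carrier) → Set ℓ
  Recurrence r α = ∀ p m → p < r → m < r →
    α (suc p) (2 ℕ.+ m) * α (suc p) m + α p (suc m) * α (2 ℕ.+ p) (suc m) ≈ 0#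

  ⁻¹-unique : ∀ {x y} → ¬ x ≈ 0# → x * y ≈ 1# → x ⁻¹ ≈ y
  ⁻¹-unique {x} {y} x≉0 xy≈1 = begin
    x ⁻¹           ≈⟨ sym (*-identityʳ _) ⟩
    x ⁻¹ * 1#      ≈⟨ *-congˡ (sym xy≈1) ⟩
    x ⁻¹ * (x * y) ≈⟨ solve 3 (λ i x y → i :* (x :* y) := (x :* i) :* y) refl _ _ _ ⟩
    (x * x ⁻¹) * y ≈⟨ *-congʳ (⁻¹-inverse x x≉0) ⟩
    1# * y         ≈⟨ *-identityˡ y ⟩
    y              ∎

  -- Congruence of the inverse is not among the axioms of `Field`; for nonzero arguments it follows
  -- from uniqueness of inverses.
  ⁻¹-cong : ∀ {x y} → ¬ x ≈ 0# → x ≈ y → x ⁻¹ ≈ y ⁻¹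
  ⁻¹-cong {x} {y} x≉0 x≈y = ⁻¹-unique x≉0
    (trans (*-congʳ x≈y) (⁻¹-inverse y (λ y≈0 → x≉0 (trans x≈y y≈0))))

  *-cancelˡ : ∀ {x y z} → ¬ x ≈ 0# → x * y ≈ x * z → y ≈ z
  *-cancelˡ {x} {y} {z} x≉0 xy≈xz = begin
    y              ≈⟨ lemma y ⟩
    x ⁻¹ * (x * y) ≈⟨ *-congˡ xy≈xz ⟩
    x ⁻¹ * (x * z) ≈⟨ sym (lemma z) ⟩
    z              ∎
    where
    lemma : ∀ t → t ≈ x ⁻¹ * (x * t)
    lemma t = trans (sym (*-identityˡ t)) (trans (*-congʳ (sym (⁻¹-inverse x x≉0)))
      (solve 3 (λ i x y → (x :* i) :* y := i :* (x :* y)) refl _ _ _))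

  *⁻¹-identityʳ : ∀ x {y} → y ≈ 1# → x * y ⁻¹ ≈ x
  *⁻¹-identityʳ x {y} y≈1 = trans (*-congˡ (⁻¹-unique (λ y≈0 → 1≉0 (trans (sym y≈1) y≈0)) (trans
      (*-identityʳ y) y≈1))) (*-identityʳ x)

  *⁻¹*-cancel : ∀ x {y} → ¬ y ≈ 0# → (x * y ⁻¹) * y ≈ x
  *⁻¹*-cancel x {y} y≉0 = trans (solve 3 (λ x i y → (x :* i) :* y := x :* (y :* i)) refl _ _ _)
    (trans (*-congˡ (⁻¹-inverse y y≉0)) (*-identityʳ x))

  -- Over the common denominator `b * e` the numerator is the left side of the last hypothesis.
  fractions-sum-zero : ∀ {a b d e} → ¬ b ≈ 0# → ¬ e ≈ 0# → a * e + b * d ≈ 0# → a * b ⁻¹ + d * e ⁻¹ ≈ 0#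
  fractions-sum-zero {a} {b} {d} {e} b≉0 e≉0 eq = begin
    a * b ⁻¹ + d * e ⁻¹
      ≈⟨ +-cong (times1 (⁻¹-inverse e e≉0)) (times1 (⁻¹-inverse b b≉0)) ⟩
    (a * b ⁻¹) * (e * e ⁻¹) + (d * e ⁻¹) * (b * b ⁻¹)
      ≈⟨ solve 6 (λ a b b' d e e' → (a :* b') :* (e :* e') :+ (d :* e') :* (b :* b') :=
          (a :* e :+ b :* d) :* (b' :* e')) refl _ _ _ _ _ _ ⟩
    (a * e + b * d) * (b ⁻¹ * e ⁻¹)
      ≈⟨ *-congʳ eq ⟩
    0# * (b ⁻¹ * e ⁻¹)
      ≈⟨ zeroˡ _ ⟩
    0# ∎
    where
    times1 : ∀ {x y} → y ≈ 1# → x ≈ x * y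
    times1 {x} y≈1 = trans (sym (*-identityʳ x)) (*-congˡ (sym y≈1))

  -- The induction step for a quantity that changes sign at each move along a diagonal.
  σ-suc-* : ∀ n {x y z} → x + y ≈ 0# → y ≈ σ n * z → x ≈ σ (suc n) * z
  σ-suc-* n {x} {y} {z} x+y≈0 y≈ = begin
    x             ≈⟨ +-inverse-unique x y x+y≈0 ⟩
    - y           ≈⟨ -‿cong y≈ ⟩
    - (σ n * z)   ≈⟨ -‿distribˡ-* _ _ ⟩
    - σ n * z     ∎

  σ²≈1 : ∀ n → σ n * σ n ≈ 1#
  σ²≈1 zero    = *-identityˡ 1#
  σ²≈1 (suc n) = begin
    - σ n * - σ n     ≈⟨ sym (-‿distribˡ-* _ _) ⟩
    - (σ n * - σ n)   ≈⟨ -‿cong (*-comm _ _) ⟩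
    - (- σ n * σ n)   ≈⟨ -‿cong (sym (-‿distribˡ-* _ _)) ⟩
    - (- (σ n * σ n)) ≈⟨ -‿involutive _ ⟩
    σ n * σ n         ≈⟨ σ²≈1 n ⟩
    1#                ∎

  sign : Bool → Carrier
  sign b = if b then - 1# else 1#

  σ≈sign : ∀ n → σ n ≈ sign (parity n)
  σ≈sign zero = refl
  σ≈sign (suc n) with parity n | σ≈sign n
  ... | true  | eq = trans (-‿cong eq) (-‿involutive 1#)
  ... | false | eq = -‿cong eq

  σ-parity : ∀ m n → parity m ≡ parity n → σ m ≈ σ n
  σ-parity m n eq = trans (σ≈sign m) (trans (reflexive (≡.cong sign eq)) (sym (σ≈sign n)))

  σ-even : ∀ n → parity n ≡ false → σ n ≈ 1#
  σ-even n = σ-parity n 0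

  σ*-≉0 : ∀ n {x} → ¬ x ≈ 0# → ¬ σ n * x ≈ 0#
  σ*-≉0 n {x} x≉0 eq = x≉0 (begin
    x               ≈⟨ sym (*-identityˡ x) ⟩
    1# * x          ≈⟨ *-congʳ (sym (σ²≈1 n)) ⟩
    (σ n * σ n) * x ≈⟨ *-assoc _ _ _ ⟩
    σ n * (σ n * x) ≈⟨ *-congˡ eq ⟩
    σ n * 0#        ≈⟨ zeroʳ _ ⟩
    0#              ∎)

  ⁻¹-σ* : ∀ n {x} → ¬ x ≈ 0# → (σ n * x) ⁻¹ ≈ σ n * x ⁻¹
  ⁻¹-σ* n {x} x≉0 = ⁻¹-unique (σ*-≉0 n x≉0) (begin
    (σ n * x) * (σ n * x ⁻¹) ≈⟨ solve 3 (λ s x i → (s :* x) :* (s :* i) := (s :* s) :* (x :* i)) refl _ _ _ ⟩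
    (σ n * σ n) * (x * x ⁻¹) ≈⟨ *-cong (σ²≈1 n) (⁻¹-inverse x x≉0) ⟩
    1# * 1#                  ≈⟨ *-identityˡ 1# ⟩
    1#                       ∎)

  parity-+ : ∀ m n → parity (m ℕ.+ n) ≡ parity m xor parity n
  parity-+ zero    n = ≡.refl
  parity-+ (suc m) n = ≡.trans (≡.cong not (parity-+ m n)) (Boolₚ.not-distribˡ-xor (parity m) (parity n))

  parity-* : ∀ m n → parity (m ℕ.* n) ≡ parity m ∧ parity n
  parity-* zero    n = ≡.refl
  parity-* (suc m) n = ≡.trans (parity-+ n (m ℕ.* n))
    (≡.trans (≡.cong (parity n xor_) (parity-* m n)) (lemma (parity m) (parity n)))
    where
    lemma : ∀ a b → b xor (a ∧ b) ≡ not a ∧ b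
    lemma false b     = Boolₚ.xor-identityʳ b
    lemma true  false = ≡.refl
    lemma true  true  = ≡.refl

  parity-+suc : ∀ m n → parity (m ℕ.+ suc n) ≡ parity (suc m ℕ.+ n)
  parity-+suc m n = ≡.cong parity (ℕₚ.+-suc m n)

-- The ratios λ and ρ along the diagonals, and the outer entries of the array.

module Dynamics {c ℓ : Level} (F : Field c ℓ) (r : ℕ)
  (α : ℕ → ℕ → Field.Carrier F)
  (α≉0 : ∀ p m → p ≤ suc r → m ≤ suc r → ¬ (Field._≈_ F (α p m) (Field.0# F)))
  (α-left : ∀ m → Field._≈_ F (α 0 m) (Field.1# F))
  (α-right : ∀ m → Field._≈_ F (α (suc r) m) (Field.1# F))
  (α-init : ∀ p → Field._≈_ F (α p 0) (Field.1# F))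
  (α-rec : FieldLemmas.Recurrence F r α)
  where
  open Field F
  open FieldLemmas F
  open import Algebra.Properties.Ring ring using (-‿distribˡ-*)
  open import Algebra.Properties.AbelianGroup +-abelianGroup using () renaming (∙-cancelˡ to +-cancelˡ)
  open import Relation.Binary.Reasoning.Setoid setoid
  open import Algebra.Solver.Ring.NaturalCoefficients.Default commutativeSemiring

  -- The weights of the left and the right neighbour in the update of position p + 1; the index is
  -- one less than the position.
  lam rho : ℕ → ℕ → Carrier
  lam p m = α (suc p) (suc m) * α p m ⁻¹
  rho p m = α p (suc m) * α (suc p) m ⁻¹

  -- Over a common denominator the numerator is the recurrence. `rho-flip` is the same relation with
  -- the factors paired the other way.
  lam-flip : ∀ p m → p < r → m < r → lam p (suc m) + lam (suc p) m ≈ 0#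
  lam-flip p m p<r m<r = fractions-sum-zero
    (α≉0 _ _ (ℕₚ.m≤n⇒m≤1+n (ℕₚ.<⇒≤ p<r)) (ℕₚ.m≤n⇒m≤1+n m<r)) (α≉0 _ _ (ℕₚ.m≤n⇒m≤1+n p<r) (ℕₚ.m≤n⇒m≤1+n
        (ℕₚ.<⇒≤ m<r)))
    (α-rec p m p<r m<r)

  rho-flip : ∀ p m → p < r → m < r → rho (suc p) (suc m) + rho p m ≈ 0#
  rho-flip p m p<r m<r = fractions-sum-zero
    (α≉0 _ _ (s≤s p<r) (ℕₚ.m≤n⇒m≤1+n m<r)) (α≉0 _ _ (ℕₚ.m≤n⇒m≤1+n p<r) (ℕₚ.m≤n⇒m≤1+n (ℕₚ.<⇒≤ m<r)))
    (trans (+-congˡ (*-comm _ _)) (α-rec p m p<r m<r))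

  -- `lam` alternates in sign while p + m is constant, `rho` while p - m is constant. The endpoints
  -- enter through equations so that callers may present them in any form.
  lam-iter : ∀ n p m {p′ m′} → n ℕ.+ p ≡ p′ → n ℕ.+ m ≡ m′ → p′ ≤ r → m′ ≤ r → lam p m′ ≈ σ n * lam p′ m
  lam-iter zero    p m ≡.refl ≡.refl _ _ = sym (*-identityˡ _)
  lam-iter (suc n) p m ≡.refl ≡.refl p≤ m≤ = σ-suc-* n
    (lam-flip p (n ℕ.+ m) (ℕₚ.≤-trans (s≤s (ℕₚ.m≤n+m p n)) p≤) m≤)
    (lam-iter n (suc p) m (ℕₚ.+-suc n p) ≡.refl p≤ (ℕₚ.<⇒≤ m≤))

  rho-iter : ∀ n p m {p′ m′} → n ℕ.+ p ≡ p′ → n ℕ.+ m ≡ m′ → p′ ≤ r → m′ ≤ r → rho p′ m′ ≈ σ n * rho p m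
  rho-iter zero    p m ≡.refl ≡.refl _ _ = sym (*-identityˡ _)
  rho-iter (suc n) p m ≡.refl ≡.refl p≤ m≤ = σ-suc-* n
    (rho-flip _ _ p≤ m≤) (rho-iter n p m ≡.refl ≡.refl (ℕₚ.<⇒≤ p≤) (ℕₚ.<⇒≤ m≤))

  -- On the sides where `α` equals 1 the ratios collapse to one entry or its inverse; following a
  -- diagonal to such a side evaluates them elsewhere.
  lam-init : ∀ p → lam p 0 ≈ α (suc p) 1
  lam-init p = *⁻¹-identityʳ _ (α-init p)

  rho-init : ∀ p → rho p 0 ≈ α p 1
  rho-init p = *⁻¹-identityʳ _ (α-init (suc p))

  lam-left : ∀ m → lam 0 m ≈ α 1 (suc m)
  lam-left m = *⁻¹-identityʳ _ (α-left m)

  rho-right : ∀ m → rho r m ≈ α r (suc m)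
  rho-right m = *⁻¹-identityʳ _ (α-right m)

  rho-left : ∀ m → rho 0 m ≈ α 1 m ⁻¹
  rho-left m = trans (*-congʳ (α-left (suc m))) (*-identityˡ _)

  lam-right : ∀ m → lam r m ≈ α r m ⁻¹
  lam-right m = trans (*-congʳ (α-right (suc m))) (*-identityˡ _)

  -- The diagonal of `lam` through (0, n) ends at (n, 0), and both end values are single entries of
  -- the array.
  α-column-1 : ∀ n → n ≤ r → α 1 (suc n) ≈ σ n * α (suc n) 1
  α-column-1 n n≤r = trans (sym (lam-left n))
    (trans (lam-iter n 0 0 (ℕₚ.+-identityʳ n) (ℕₚ.+-identityʳ n) n≤r n≤r) (*-congˡ (lam-init n)))

  α-column-r : ∀ p n → p ℕ.+ n ≡ r → α r (suc p) ≈ σ p * α n 1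
  α-column-r p n eq = trans (sym (rho-right p))
    (trans (rho-iter p n 0 eq (ℕₚ.+-identityʳ p) ℕₚ.≤-refl (ℕₚ.m+n≤o⇒m≤o p (ℕₚ.≤-reflexive eq)))
           (*-congˡ (rho-init n)))

  rho-row-r : ∀ p n → p ℕ.+ n ≡ r → rho p r ≈ σ p * α 1 n ⁻¹
  rho-row-r p n eq = trans
    (rho-iter p 0 n (ℕₚ.+-identityʳ p) eq (ℕₚ.m+n≤o⇒m≤o p (ℕₚ.≤-reflexive eq)) ℕₚ.≤-refl)
    (*-congˡ (rho-left n))

  lam-row-r : ∀ n p → n ℕ.+ p ≡ r → lam p r ≈ σ n * α r p ⁻¹
  lam-row-r n p eq = trans (lam-iter n p p eq eq ℕₚ.≤-refl ℕₚ.≤-refl) (*-congˡ (lam-right p))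

  -- The two entries are the numerators of `lam (suc p) r` and `rho p r`, which share the
  -- denominator `α (suc p) r`. Followed back to the sides, both ratios become the inverse of
  -- `α (suc n) 1` with the same sign.
  α-row-suc-r-step : ∀ p n → p ℕ.+ suc n ≡ r → α (2 ℕ.+ p) (suc r) ≈ α p (suc r)
  α-row-suc-r-step p n eq = begin
    α (2 ℕ.+ p) (suc r)         ≈⟨ sym (*⁻¹*-cancel _ αpr≉0) ⟩
    lam (suc p) r * α (suc p) r ≈⟨ *-congʳ lam≈rho ⟩
    rho p r * α (suc p) r       ≈⟨ *⁻¹*-cancel _ αpr≉0 ⟩
    α p (suc r)                 ∎
    where
    p<r : suc p ≤ r
    p<r = ℕₚ.m+n≤o⇒m≤o (suc p) (ℕₚ.≤-reflexive (≡.trans (≡.sym (ℕₚ.+-suc p n)) eq))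
    n<r : suc n ≤ r
    n<r = ℕₚ.m+n≤o⇒n≤o p (ℕₚ.≤-reflexive eq)
    αpr≉0 : ¬ α (suc p) r ≈ 0#
    αpr≉0 = α≉0 _ _ (ℕₚ.m≤n⇒m≤1+n p<r) (ℕₚ.n≤1+n r)
    x≉0 : ¬ α (suc n) 1 ≈ 0#
    x≉0 = α≉0 _ _ (ℕₚ.m≤n⇒m≤1+n n<r) (s≤s z≤n)
    lam≈rho : lam (suc p) r ≈ rho p r
    lam≈rho = begin
      lam (suc p) r                ≈⟨ lam-row-r n (suc p) (≡.trans (≡.trans (ℕₚ.+-suc n p) (≡.cong suc
          (ℕₚ.+-comm n p))) (≡.trans (≡.sym (ℕₚ.+-suc p n)) eq)) ⟩
      σ n * α r (suc p) ⁻¹         ≈⟨ *-congˡ (trans (⁻¹-cong (α≉0 _ _ (ℕₚ.n≤1+n r) (ℕₚ.m≤n⇒m≤1+n p<r))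
          (α-column-r p (suc n) eq)) (⁻¹-σ* p x≉0)) ⟩
      σ n * (σ p * α (suc n) 1 ⁻¹) ≈⟨ solve 3 (λ s t x → s :* (t :* x) := t :* (s :* x)) refl _ _ _ ⟩
      σ p * (σ n * α (suc n) 1 ⁻¹) ≈⟨ *-congˡ (sym (trans (⁻¹-cong (α≉0 _ _ (s≤s z≤n) (ℕₚ.m≤n⇒m≤1+n n<r))
          (α-column-1 n (ℕₚ.<⇒≤ n<r))) (⁻¹-σ* n x≉0))) ⟩
      σ p * α 1 (suc n) ⁻¹         ≈⟨ sym (rho-row-r p (suc n) eq) ⟩
      rho p r ∎

  -- Induction in steps of two from the entries 0 and 1; adding 2 to p does not change the parity of
  -- p r.
  α-row-suc-r : ∀ p → p ≤ suc r → α p (suc r) ≈ σ (p ℕ.* r)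
  α-row-suc-r zero          p≤ = α-left _
  α-row-suc-r (suc zero)    p≤ = trans (α-column-1 r ℕₚ.≤-refl) (trans (*-congˡ (α-right 1))
    (trans (*-identityʳ _) (reflexive (≡.cong σ (≡.sym (ℕₚ.+-identityʳ r))))))
  α-row-suc-r (suc (suc p)) (s≤s p<r) = begin
    α (2 ℕ.+ p) (suc r)        ≈⟨ α-row-suc-r-step p (r ∸ suc p) (≡.trans (ℕₚ.+-suc p _) (ℕₚ.m+[n∸m]≡n p<r)) ⟩
    α p (suc r)                ≈⟨ α-row-suc-r p (ℕₚ.m≤n⇒m≤1+n (ℕₚ.<⇒≤ p<r)) ⟩
    σ (p ℕ.* r)                ≈⟨ σ-parity (p ℕ.* r) ((2 ℕ.+ p) ℕ.* r) parity≡ ⟩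
    σ ((2 ℕ.+ p) ℕ.* r)        ∎
    where
    parity≡ : parity (p ℕ.* r) ≡ parity ((2 ℕ.+ p) ℕ.* r)
    parity≡ = ≡.trans (parity-* p r) (≡.trans (≡.cong (_∧ parity r) (≡.sym (Boolₚ.not-involutive (parity p))))
      (≡.sym (parity-* (2 ℕ.+ p) r)))

  -- The discrete wave equation: propagation, reflection and the column at time r + 1.

  module Flow (W : ℕ → ℕ → Carrier)
    (W-left : ∀ m → W m 0 ≈ 0#) (W-right : ∀ m → W m (2 ℕ.+ r) ≈ 0#)
    (update : ∀ p m → p ≤ r → m ≤ r → parity (suc p ℕ.+ m) ≡ false →
       W (suc m) (suc p) ≈ lam p m * W m p + (lam p m * rho p m * W m (suc p) + rho p m * W m (2 ℕ.+ p)))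
    (stay : ∀ p m → m ≤ r → parity (p ℕ.+ m) ≡ true → W (suc m) p ≈ W m p)
    where

    v : ℕ → Carrier
    v = W 0

    -- The left- and right-moving parts of W (suc m) at position suc p equal f; no subtraction occurs.
    Left Right : ℕ → ℕ → Carrier → Set ℓ
    Left  p m f = W (suc m) (suc p) ≈ lam p m * W (suc m) p + α p (suc m) * f
    Right p m f = W (suc m) (suc p) ≈ rho p m * W (suc m) (2 ℕ.+ p) + α (suc p) (suc m) * f

    -- After inserting the hypothesis for the right neighbour, the terms in `W (suc m) (suc p)`
    -- carry the factor of `lam-flip` and vanish, while `rho p (suc m)` turns the weight of `f` into
    -- `α p (2 + m)`.
    Left-step : ∀ p m f → p < r → m < r → parity (2 ℕ.+ p ℕ.+ m) ≡ false → Left (suc p) m f → Left p (suc m) f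
    Left-step p m f p<r m<r even eq = begin
      W (2 ℕ.+ m) (suc p)
        ≈⟨ update p (suc m) (ℕₚ.<⇒≤ p<r) m<r even′ ⟩
      lam p (suc m) * W (suc m) p + (lam p (suc m) * rho p (suc m) * W (suc m) (suc p) + rho p (suc m) * W
          (suc m) (2 ℕ.+ p))
        ≈⟨ +-congˡ (+-congˡ (*-congˡ eq)) ⟩
      lam p (suc m) * W (suc m) p + (lam p (suc m) * rho p (suc m) * W (suc m) (suc p)
        + rho p (suc m) * (lam (suc p) m * W (suc m) (suc p) + α (suc p) (suc m) * f))
        ≈⟨ solve 7 (λ l u R w m a f → l :* u :+ (l :* R :* w :+ R :* (m :* w :+ a :* f))
                       := l :* u :+ ((l :+ m) :* (R :* w) :+ (R :* a) :* f)) refl _ _ _ _ _ _ _ ⟩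
      lam p (suc m) * W (suc m) p + ((lam p (suc m) + lam (suc p) m) * (rho p (suc m) * W (suc m) (suc p))
        + (rho p (suc m) * α (suc p) (suc m)) * f)
        ≈⟨ +-cong (*-congˡ (sym (stay p (suc m) m<r (not-false even′))))
             (+-cong (*-congʳ (lam-flip p m p<r m<r))
                (*-congʳ (*⁻¹*-cancel _ (α≉0 _ _ (ℕₚ.m≤n⇒m≤1+n p<r) (ℕₚ.m≤n⇒m≤1+n m<r))))) ⟩
      lam p (suc m) * W (2 ℕ.+ m) p + (0# * _ + α p (2 ℕ.+ m) * f)
        ≈⟨ +-congˡ (trans (+-congʳ (zeroˡ _)) (+-identityˡ _)) ⟩
      lam p (suc m) * W (2 ℕ.+ m) p + α p (2 ℕ.+ m) * f ∎
      where
      even′ : parity (suc p ℕ.+ suc m) ≡ false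
      even′ = ≡.trans (parity-+suc (suc p) m) even

    -- The mirror image: the left neighbour is replaced and `rho-flip` removes the middle term.
    Right-step : ∀ p m f → p < r → m < r → parity (suc p ℕ.+ m) ≡ false → Right p m f → Right (suc p) (suc m) f
    Right-step p m f p<r m<r even eq = begin
      W (2 ℕ.+ m) (2 ℕ.+ p)
        ≈⟨ update (suc p) (suc m) p<r m<r even′ ⟩
      L * W (suc m) (suc p) + (L * R * W (suc m) (2 ℕ.+ p) + R * W (suc m) (3 ℕ.+ p))
        ≈⟨ +-congʳ (*-congˡ eq) ⟩
      L * (rho p m * W (suc m) (2 ℕ.+ p) + α (suc p) (suc m) * f) + (L * R * W (suc m) (2 ℕ.+ p) + R * W
          (suc m) (3 ℕ.+ p))
        ≈⟨ solve 7 (λ l u R w m a f → l :* (m :* w :+ a :* f) :+ (l :* R :* w :+ R :* u)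
                       := R :* u :+ ((R :+ m) :* (l :* w) :+ (l :* a) :* f)) refl _ _ _ _ _ _ _ ⟩
      R * W (suc m) (3 ℕ.+ p) + ((R + rho p m) * (L * W (suc m) (2 ℕ.+ p)) + (L * α (suc p) (suc m)) * f)
        ≈⟨ +-cong (*-congˡ (sym (stay (3 ℕ.+ p) (suc m) m<r (≡.cong not even′))))
             (+-cong (*-congʳ (rho-flip p m p<r m<r))
                (*-congʳ (*⁻¹*-cancel _ (α≉0 _ _ (ℕₚ.m≤n⇒m≤1+n p<r) (ℕₚ.m≤n⇒m≤1+n m<r))))) ⟩
      R * W (2 ℕ.+ m) (3 ℕ.+ p) + (0# * _ + α (2 ℕ.+ p) (2 ℕ.+ m) * f)
        ≈⟨ +-congˡ (trans (+-congʳ (zeroˡ _)) (+-identityˡ _)) ⟩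
      R * W (2 ℕ.+ m) (3 ℕ.+ p) + α (2 ℕ.+ p) (2 ℕ.+ m) * f ∎
      where
      L = lam (suc p) (suc m)
      R = rho (suc p) (suc m)
      even′ : parity (2 ℕ.+ p ℕ.+ suc m) ≡ false
      even′ = ≡.trans (parity-+suc (2 ℕ.+ p) m) (≡.cong (λ b → not (not b)) even)

    Left-iter : ∀ n p m f {p′ m′} → n ℕ.+ p ≡ p′ → n ℕ.+ m ≡ m′ → p′ ≤ r → m′ ≤ r →
      parity (suc p′ ℕ.+ m) ≡ false → Left p′ m f → Left p m′ f
    Left-iter zero    p m f ≡.refl ≡.refl _ _ _ eq = eq
    Left-iter (suc n) p m f ≡.refl e₂ p≤ m≤ even eq =
      Left-iter n p (suc m) f ≡.refl (≡.trans (ℕₚ.+-suc n m) e₂) (ℕₚ.<⇒≤ p≤) m≤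
        (≡.trans (parity-+suc (suc (n ℕ.+ p)) m) even)
        (Left-step _ m f p≤ (ℕₚ.≤-trans (s≤s (ℕₚ.m≤n+m m n)) (ℕₚ.≤-trans (ℕₚ.≤-reflexive e₂) m≤)) even eq)

    Right-iter : ∀ n p m f {p′ m′} → n ℕ.+ p ≡ p′ → n ℕ.+ m ≡ m′ → p′ ≤ r → m′ ≤ r →
      parity (suc p ℕ.+ m) ≡ false → Right p m f → Right p′ m′ f
    Right-iter zero    p m f ≡.refl ≡.refl _ _ _ eq = eq
    Right-iter (suc n) p m f e₁ e₂ p≤ m≤ even eq =
      Right-iter n (suc p) (suc m) f (≡.trans (ℕₚ.+-suc n p) e₁) (≡.trans (ℕₚ.+-suc n m) e₂) p≤ m≤
        (≡.trans (parity-+suc (2 ℕ.+ p) m) (≡.cong (λ b → not (not b)) even))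
        (Right-step p m f (ℕₚ.≤-trans (s≤s (ℕₚ.m≤n+m p n)) (ℕₚ.≤-trans (ℕₚ.≤-reflexive e₁) p≤))
           (ℕₚ.≤-trans (s≤s (ℕₚ.m≤n+m m n)) (ℕₚ.≤-trans (ℕₚ.≤-reflexive e₂) m≤)) even eq)

    -- The amounts carried before reflection, `f` to the left and `e` to the right.
    f e : ℕ → Carrier
    f k = v (suc k) + α k 1 * v k
    e k = v k + α k 1 * v (suc k)

    -- Collect the terms with `rho p 0`; since row 0 of the array is 1, both weights are entries of
    -- row 1.
    Left-init : ∀ p → p ≤ r → parity (suc p) ≡ false → Left p 0 (f (suc p))
    Left-init p p≤r even = begin
      W 1 (suc p)
        ≈⟨ update p 0 p≤r z≤n even′ ⟩
      lam p 0 * v p + (lam p 0 * rho p 0 * v (suc p) + rho p 0 * v (2 ℕ.+ p))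
        ≈⟨ solve 5 (λ l u R w x → l :* u :+ (l :* R :* w :+ R :* x) := l :* u :+ R :*
            (x :+ l :* w)) refl _ _ _ _ _ ⟩
      lam p 0 * v p + rho p 0 * (v (2 ℕ.+ p) + lam p 0 * v (suc p))
        ≈⟨ +-cong (*-congˡ (sym (stay p 0 z≤n (not-false even′))))
                  (*-cong (rho-init p) (+-congˡ (*-congʳ (lam-init p)))) ⟩
      lam p 0 * W 1 p + α p 1 * f (suc p) ∎
      where
      even′ : parity (suc p ℕ.+ 0) ≡ false
      even′ = ≡.trans (≡.cong parity (ℕₚ.+-identityʳ (suc p))) even

    Right-init : ∀ p → p ≤ r → parity (suc p) ≡ false → Right p 0 (e p)
    Right-init p p≤r even = begin
      W 1 (suc p)
        ≈⟨ update p 0 p≤r z≤n even′ ⟩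
      lam p 0 * v p + (lam p 0 * rho p 0 * v (suc p) + rho p 0 * v (2 ℕ.+ p))
        ≈⟨ solve 5 (λ l u R w x → l :* u :+ (l :* R :* w :+ R :* x) := R :* x :+ l :*
            (u :+ R :* w)) refl _ _ _ _ _ ⟩
      rho p 0 * v (2 ℕ.+ p) + lam p 0 * (v p + rho p 0 * v (suc p))
        ≈⟨ +-cong (*-congˡ (sym (stay (2 ℕ.+ p) 0 z≤n (≡.cong not even′))))
                  (*-cong (lam-init p) (+-congˡ (*-congʳ (rho-init p)))) ⟩
      rho p 0 * W 1 (2 ℕ.+ p) + α (suc p) 1 * e p ∎
      where
      even′ : parity (suc p ℕ.+ 0) ≡ false
      even′ = ≡.trans (≡.cong parity (ℕₚ.+-identityʳ (suc p))) even

    +-*0ʳ : ∀ {x y z} → z ≈ 0# → x + y * z ≈ x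
    +-*0ʳ {x} {y} z≈0 = trans (+-congˡ (trans (*-congˡ z≈0) (zeroʳ y))) (+-identityʳ x)

    *0-+ˡ : ∀ {x y z} → z ≈ 0# → y * z + x ≈ x
    *0-+ˡ z≈0 = trans (+-comm _ _) (+-*0ʳ z≈0)

    -- The left-moving part `f k`, at position k at time 1, reaches position 1 at time k, where the
    -- left neighbour is 0 and its weight is `α 0 k`, that is 1.
    W-first : ∀ k → k ≤ suc r → parity k ≡ false → W k 1 ≈ f k
    W-first zero    _         _    = sym (+-*0ʳ (W-left 0))
    W-first (suc k) (s≤s k≤r) even = begin
      W (suc k) 1
        ≈⟨ Left-iter k 0 0 (f (suc k)) (ℕₚ.+-identityʳ k) (ℕₚ.+-identityʳ k) k≤r k≤r
             (≡.trans (≡.cong parity (ℕₚ.+-identityʳ (suc k))) even) (Left-init k k≤r even) ⟩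
      lam 0 k * W (suc k) 0 + α 0 (suc k) * f (suc k)
        ≈⟨ *0-+ˡ (W-left (suc k)) ⟩
      α 0 (suc k) * f (suc k)
        ≈⟨ trans (*-congʳ (α-left (suc k))) (*-identityˡ _) ⟩
      f (suc k) ∎

    -- The right-moving part `e n` starts at position n + 1 at time 1 and arrives at position r + 1
    -- at time k.
    W-last : ∀ k n → k ℕ.+ n ≡ suc r → parity n ≡ true → W k (suc r) ≈ e n
    W-last zero    n ≡.refl _   = sym (+-*0ʳ (W-right 0))
    W-last (suc k) n eq     odd = begin
      W (suc k) (suc r)
        ≈⟨ Right-iter k n 0 (e n) k+n≡r (ℕₚ.+-identityʳ k) ℕₚ.≤-refl (ℕₚ.m+n≤o⇒m≤o k (ℕₚ.≤-reflexive k+n≡r))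
             (≡.trans (≡.cong parity (ℕₚ.+-identityʳ (suc n))) (≡.cong not odd))
             (Right-init n (ℕₚ.m+n≤o⇒n≤o k (ℕₚ.≤-reflexive k+n≡r)) (≡.cong not odd)) ⟩
      rho r k * W (suc k) (2 ℕ.+ r) + α (suc r) (suc k) * e n
        ≈⟨ *0-+ˡ (W-right (suc k)) ⟩
      α (suc r) (suc k) * e n
        ≈⟨ trans (*-congʳ (α-right (suc k))) (*-identityˡ _) ⟩
      e n ∎
      where
      k+n≡r : k ℕ.+ n ≡ r
      k+n≡r = ℕₚ.suc-injective eq

    -- Position 1 holds `f n` at time n and keeps it for one step. The next update has left
    -- neighbour 0, so `f n` travels back to the right, scaled by the inverse of `α 1 (suc n)`.
    Right-reflected : ∀ n → suc n ≤ r → parity n ≡ false → Right 0 (suc n) (α 1 (suc n) ⁻¹ * f n)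
    Right-reflected n n<r even = begin
      W (2 ℕ.+ n) 1
        ≈⟨ update 0 (suc n) z≤n n<r (≡.cong (λ b → not (not b)) even) ⟩
      L * W (suc n) 0 + (L * R * W (suc n) 1 + R * W (suc n) 2)
        ≈⟨ *0-+ˡ (W-left (suc n)) ⟩
      L * R * W (suc n) 1 + R * W (suc n) 2
        ≈⟨ +-comm _ _ ⟩
      R * W (suc n) 2 + L * R * W (suc n) 1
        ≈⟨ +-cong (*-congˡ (sym (stay 2 (suc n) n<r (≡.cong (λ b → not (not (not b))) even))))
             (*-cong (*-cong (lam-left (suc n)) (rho-left (suc n)))
                     (trans (stay 1 n (ℕₚ.<⇒≤ n<r) (≡.cong not even)) (W-first n (ℕₚ.m≤n⇒m≤1+n
                         (ℕₚ.<⇒≤ n<r)) even))) ⟩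
      R * W (2 ℕ.+ n) 2 + α 1 (2 ℕ.+ n) * α 1 (suc n) ⁻¹ * f n
        ≈⟨ +-congˡ (*-assoc _ _ _) ⟩
      R * W (2 ℕ.+ n) 2 + α 1 (2 ℕ.+ n) * (α 1 (suc n) ⁻¹ * f n) ∎
      where
      L = lam 0 (suc n)
      R = rho 0 (suc n)

    -- The same at the right end: `e n` sits at position r + 1 and the right neighbour is the
    -- padding.
    Left-reflected : ∀ k n → k ℕ.+ n ≡ suc r → suc k ≤ r → parity n ≡ true → Left r (suc k) (α r
        (suc k) ⁻¹ * e n)
    Left-reflected k n eq k<r odd = begin
      W (2 ℕ.+ k) (suc r)
        ≈⟨ update r (suc k) ℕₚ.≤-refl k<r even ⟩
      L * W (suc k) r + (L * R * W (suc k) (suc r) + R * W (suc k) (2 ℕ.+ r))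
        ≈⟨ +-congˡ (+-*0ʳ (W-right (suc k))) ⟩
      L * W (suc k) r + L * R * W (suc k) (suc r)
        ≈⟨ +-cong (*-congˡ (sym (stay r (suc k) k<r (not-false even))))
             (*-cong (*-cong (lam-right (suc k)) (rho-right (suc k)))
                     (trans (stay (suc r) k (ℕₚ.<⇒≤ k<r) (not-false (≡.trans (≡.sym (parity-+suc
                         (suc r) k)) even))) (W-last k n eq odd))) ⟩
      L * W (2 ℕ.+ k) r + α r (suc k) ⁻¹ * α r (2 ℕ.+ k) * e n
        ≈⟨ +-congˡ (solve 3 (λ i a x → i :* a :* x := a :* (i :* x)) refl _ _ _) ⟩
      L * W (2 ℕ.+ k) r + α r (2 ℕ.+ k) * (α r (suc k) ⁻¹ * e n) ∎
      where
      L = lam r (suc k)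
      R = rho r (suc k)
      -- The sum contains k twice, so only the odd n and the final 1 count.
      parities : ∀ k n → parity n ≡ true → parity (k ℕ.+ n ℕ.+ suc k) ≡ false
      parities zero    n odd = ≡.trans (≡.cong parity (ℕₚ.+-comm n 1)) (≡.cong not odd)
      parities (suc k) n odd = ≡.trans (≡.cong not (parity-+suc (k ℕ.+ n) (suc k))) (≡.trans
          (Boolₚ.not-involutive _) (parities k n odd))
      even : parity (suc r ℕ.+ suc k) ≡ false
      even = ≡.subst (λ x → parity (x ℕ.+ suc k) ≡ false) eq (parities k n odd)

    -- The reflected right-moving part at time r + 1, solved for the right-hand entry. As n is even,
    -- r and p + 1 have equal parity, so the weight `α (suc p) (suc r)` is `σ (suc p)`.
    final-A : ∀ p n → p ℕ.+ suc n ≡ r → parity n ≡ false →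
      W (suc r) (2 ℕ.+ p) ≈ f n + σ p * (α (suc n) 1 * W (suc r) (suc p))
    final-A p n eq even = sym (begin
      f n + σ p * (b * W (suc r) (suc p))
        ≈⟨ +-congˡ (*-congˡ (*-congˡ right)) ⟩
      f n + σ p * (b * ((σ p * i) * w + σ (suc p) * (i * f n)))
        ≈⟨ solve 6 (λ f s b i w t → f :+ s :* (b :* ((s :* i) :* w :+ t :* (i :* f)))
                     := ((s :* s) :* (b :* i)) :* w :+ (con 1 :+ (t :* s) :* (b :* i)) :* f) refl _ _ _ _ _ _ ⟩
      ((σ p * σ p) * (b * i)) * w + (1# + (σ (suc p) * σ p) * (b * i)) * f n
        ≈⟨ +-cong (*-congʳ (trans (*-cong (σ²≈1 p) bi≈1) (*-identityˡ 1#)))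
             (*-congʳ (+-congˡ (trans (*-cong (trans (sym (-‿distribˡ-* _ _)) (-‿cong (σ²≈1 p))) bi≈1)
                 (*-identityʳ _)))) ⟩
      1# * w + (1# + - 1#) * f n
        ≈⟨ +-cong (*-identityˡ w) (trans (*-congʳ (-‿inverseʳ 1#)) (zeroˡ _)) ⟩
      w + 0#
        ≈⟨ +-identityʳ w ⟩
      w ∎)
      where
      w = W (suc r) (2 ℕ.+ p)
      b = α (suc n) 1
      i = α 1 (suc n) ⁻¹
      n<r : suc n ≤ r
      n<r = ℕₚ.m+n≤o⇒n≤o p (ℕₚ.≤-reflexive eq)
      p<r : suc p ≤ r
      p<r = ℕₚ.m+n≤o⇒m≤o (suc p) (ℕₚ.≤-reflexive (≡.trans (≡.sym (ℕₚ.+-suc p n)) eq))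
      b≈ : α 1 (suc n) ≈ b
      b≈ = trans (α-column-1 n (ℕₚ.<⇒≤ n<r)) (trans (*-congʳ (σ-even n even)) (*-identityˡ _))
      bi≈1 : b * i ≈ 1#
      bi≈1 = trans (*-congʳ (sym b≈)) (⁻¹-inverse _ (α≉0 _ _ (s≤s z≤n) (ℕₚ.m≤n⇒m≤1+n n<r)))
      parity-r : parity r ≡ parity (suc p)
      parity-r = ≡.trans (≡.cong parity (≡.sym eq)) (≡.trans (parity-+suc p n) (≡.cong not
        (≡.trans (parity-+ p n) (≡.trans (≡.cong (parity p xor_) even) (Boolₚ.xor-identityʳ (parity p))))))
      right : W (suc r) (suc p) ≈ (σ p * i) * w + σ (suc p) * (i * f n)
      right = trans
        (Right-iter p 0 (suc n) _ (ℕₚ.+-identityʳ p) eq (ℕₚ.<⇒≤ p<r) ℕₚ.≤-refl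
          (≡.cong (λ b → not (not b)) even) (Right-reflected n n<r even))
        (+-cong (*-congʳ (rho-row-r p (suc n) eq))
                (*-congʳ (trans (α-row-suc-r (suc p) (ℕₚ.m≤n⇒m≤1+n p<r)) (σ-parity (suc p ℕ.* r) (suc p)
                   (≡.trans (parity-* (suc p) r) (≡.trans (≡.cong (parity (suc p) ∧_) parity-r)
                       (Boolₚ.∧-idem _)))))))

    -- The reflected left-moving part at time r + 1, solved for the left-hand entry. As n is odd, r
    -- and k + 1 have opposite parity, so the weight `α (suc k) (suc r)` is 1.
    final-B : ∀ k n → n ℕ.+ suc k ≡ r → parity n ≡ true →
      W (suc r) (suc k) ≈ e (2 ℕ.+ n) + σ (suc k) * (α (suc n) 1 * W (suc r) (2 ℕ.+ k))
    final-B k n eq odd = sym (begin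
      e (2 ℕ.+ n) + σ (suc k) * (α (suc n) 1 * y)
        ≈⟨ +-congˡ (trans (sym (*-assoc _ _ _)) (*-congʳ A′≈)) ⟩
      e (2 ℕ.+ n) + (σ n * A) * y
        ≈⟨ +-congˡ (*-congˡ left) ⟩
      e (2 ℕ.+ n) + (σ n * A) * ((σ n * i) * x + i * e (2 ℕ.+ n))
        ≈⟨ solve 5 (λ e s A i x → e :+ (s :* A) :* ((s :* i) :* x :+ i :* e)
                     := ((s :* s) :* (A :* i)) :* x :+ (con 1 :+ s :* (A :* i)) :* e) refl _ _ _ _ _ ⟩
      ((σ n * σ n) * (A * i)) * x + (1# + σ n * (A * i)) * e (2 ℕ.+ n)
        ≈⟨ +-cong (*-congʳ (trans (*-cong (σ²≈1 n) Ai≈1) (*-identityˡ 1#)))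
             (*-congʳ (+-congˡ (trans (*-cong (σ-parity n 1 odd) Ai≈1) (*-identityʳ _)))) ⟩
      1# * x + (1# + - 1#) * e (2 ℕ.+ n)
        ≈⟨ +-cong (*-identityˡ x) (trans (*-congʳ (-‿inverseʳ 1#)) (zeroˡ _)) ⟩
      x + 0#
        ≈⟨ +-identityʳ x ⟩
      x ∎)
      where
      x = W (suc r) (suc k)
      y = W (suc r) (2 ℕ.+ k)
      A = α r (suc k)
      i = A ⁻¹
      k<r : suc k ≤ r
      k<r = ℕₚ.m+n≤o⇒n≤o n (ℕₚ.≤-reflexive eq)
      k+n : k ℕ.+ suc n ≡ r
      k+n = ≡.trans (ℕₚ.+-suc k n) (≡.trans (ℕₚ.+-comm (suc k) n) eq)
      Ai≈1 : A * i ≈ 1#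
      Ai≈1 = ⁻¹-inverse _ (α≉0 _ _ (ℕₚ.n≤1+n r) (ℕₚ.m≤n⇒m≤1+n k<r))
      A′≈ : σ (suc k) * α (suc n) 1 ≈ σ n * A
      A′≈ = begin
        - σ k * α (suc n) 1         ≈⟨ sym (-‿distribˡ-* _ _) ⟩
        - (σ k * α (suc n) 1)       ≈⟨ -‿cong (sym (α-column-r k (suc n) k+n)) ⟩
        - A                         ≈⟨ -‿cong (sym (*-identityˡ A)) ⟩
        - (1# * A)                  ≈⟨ -‿distribˡ-* _ _ ⟩
        - 1# * A                    ≈⟨ *-congʳ (sym (σ-parity n 1 odd)) ⟩
        σ n * A                     ∎
      parity-r : parity r ≡ not (parity (suc k))
      parity-r = ≡.trans (≡.cong parity (≡.sym eq)) (≡.trans (parity-+ n (suc k)) (≡.cong (_xor parity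
          (suc k)) odd))
      last-entry : α (suc k) (suc r) ≈ 1#
      last-entry = trans (α-row-suc-r (suc k) (ℕₚ.m≤n⇒m≤1+n k<r)) (σ-even (suc k ℕ.* r)
        (≡.trans (parity-* (suc k) r) (≡.trans (≡.cong (parity (suc k) ∧_) parity-r) (Boolₚ.∧-inverseʳ
            (parity (suc k))))))
      parity-r+k : parity (suc r ℕ.+ suc k) ≡ false
      parity-r+k = ≡.trans (≡.cong not (≡.trans (parity-+ r (suc k)) (≡.cong (_xor parity (suc k)) parity-r)))
        (lemma (parity (suc k)))
        where
        lemma : ∀ b → not (not b xor b) ≡ false
        lemma true  = ≡.refl
        lemma false = ≡.refl
      left : y ≈ (σ n * i) * x + i * e (2 ℕ.+ n)
      left = trans
        (Left-iter n (suc k) (suc k) _ eq eq ℕₚ.≤-refl ℕₚ.≤-refl parity-r+k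
          (Left-reflected k (2 ℕ.+ n) (≡.trans (ℕₚ.+-suc k (suc n)) (≡.cong suc k+n)) k<r (≡.cong (λ b → not
              (not b)) odd)))
        (+-cong (*-congʳ (lam-row-r n (suc k) eq)) (trans (*-congʳ last-entry) (*-identityˡ _)))

    -- Equal to (-1)^(r-1), written with r + 1 to avoid truncated subtraction.
    τ : Carrier
    τ = σ (suc r)

    mutual
      -- Both `final-B` and `final-other` express the entry at the previous position. Their common
      -- term `e (2 + n)` cancels, and what remains is divided by the nonzero `α (suc n) 1`. Each
      -- round of the mutual induction lowers p.
      final-same : ∀ p q → p ℕ.+ q ≡ 2 ℕ.+ r → parity q ≡ false → W (suc r) p ≈ τ * v q
      final-same zero q ≡.refl _ = trans (W-left _) (sym (trans (*-congˡ (W-right 0)) (zeroʳ τ)))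
      -- Here q = r + 1 is even, so τ is 1 and `f (suc r)` is just `v (suc r)`.
      final-same (suc zero) q ≡.refl even = begin
        W (suc r) 1                              ≈⟨ W-first (suc r) ℕₚ.≤-refl even ⟩
        v (2 ℕ.+ r) + α (suc r) 1 * v (suc r)    ≈⟨ trans (+-congʳ (W-right 0)) (+-identityˡ _) ⟩
        α (suc r) 1 * v (suc r)                  ≈⟨ *-congʳ (trans (α-right 1) (sym (σ-even (suc r) even))) ⟩
        τ * v (suc r)                            ∎
      final-same (suc (suc p)) zero eq _ = begin
        W (suc r) (2 ℕ.+ p) ≡⟨ ≡.cong (W (suc r)) (≡.trans (≡.sym (ℕₚ.+-identityʳ _)) eq) ⟩
        W (suc r) (2 ℕ.+ r) ≈⟨ W-right (suc r) ⟩
        0#                  ≈⟨ sym (trans (*-congˡ (W-left 0)) (zeroʳ τ)) ⟩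
        τ * v 0             ∎
      final-same (suc (suc p)) (suc n) eq even = *-cancelˡ b≉0 (begin
        b * y               ≈⟨ sym (trans (*-congʳ (σ²≈1 (suc r))) (*-identityˡ _)) ⟩
        (τ * τ) * (b * y)   ≈⟨ *-assoc _ _ _ ⟩
        τ * (τ * (b * y))   ≈⟨ *-congˡ (+-cancelˡ (e (2 ℕ.+ n)) _ _ (trans (sym B) D)) ⟩
        τ * (b * v (suc n)) ≈⟨ solve 3 (λ t b v → t :* (b :* v) := b :* (t :* v)) refl _ _ _ ⟩
        b * (τ * v (suc n)) ∎)
        where
        b = α (suc n) 1
        y = W (suc r) (2 ℕ.+ p)
        p+n : p ℕ.+ suc n ≡ r
        p+n = ℕₚ.suc-injective (ℕₚ.suc-injective eq)
        n+p : n ℕ.+ suc p ≡ r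
        n+p = ≡.trans (ℕₚ.+-comm n (suc p)) (≡.trans (≡.sym (ℕₚ.+-suc p n)) p+n)
        b≉0 : ¬ b ≈ 0#
        b≉0 = α≉0 _ _ (ℕₚ.m≤n⇒m≤1+n (ℕₚ.m+n≤o⇒n≤o p (ℕₚ.≤-reflexive p+n))) (s≤s z≤n)
        τ≈ : σ (suc p) ≈ τ
        τ≈ = σ-parity (suc p) (suc r) (≡.cong not (≡.sym (≡.trans (≡.cong parity (≡.sym p+n))
          (≡.trans (parity-+ p (suc n)) (≡.trans (≡.cong (parity p xor_) even) (Boolₚ.xor-identityʳ
              (parity p)))))))
        B : W (suc r) (suc p) ≈ e (2 ℕ.+ n) + τ * (b * y)
        B = trans (final-B p n n+p (not-false even)) (+-congˡ (*-congʳ τ≈))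
        D : W (suc r) (suc p) ≈ e (2 ℕ.+ n) + b * v (suc n)
        D = trans (final-other p (suc n) (≡.trans (ℕₚ.+-suc p (suc n)) (≡.cong suc p+n)) even)
          (solve 3 (λ x y z → (x :+ y) :+ z := (x :+ z) :+ y) refl _ _ _)

      -- For p > 0, `final-A` refers to an entry already known from `final-same`, and the two signs
      -- τ cancel. At p = 0 the value of `W-first` at time r is kept.
      final-other : ∀ p n → p ℕ.+ suc n ≡ suc r → parity n ≡ false →
        W (suc r) (suc p) ≈ f n + α (suc n) 1 * v (2 ℕ.+ n)
      final-other zero n ≡.refl even = begin
        W (suc r) 1 ≈⟨ stay 1 r ℕₚ.≤-refl (≡.cong not even) ⟩
        W r 1       ≈⟨ W-first r (ℕₚ.n≤1+n r) even ⟩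
        f r         ≈⟨ sym (+-*0ʳ (W-right 0)) ⟩
        f r + α (suc r) 1 * v (2 ℕ.+ r) ∎
      final-other (suc p) n eq even = begin
        W (suc r) (2 ℕ.+ p)
          ≈⟨ final-A p n p+n even ⟩
        f n + σ p * (b * W (suc r) (suc p))
          ≈⟨ +-congˡ (*-cong τ≈ (*-congˡ (final-same (suc p) (2 ℕ.+ n) (≡.cong suc (≡.trans (ℕₚ.+-suc p
              (suc n)) eq)) (≡.cong (λ b → not (not b)) even)))) ⟩
        f n + τ * (b * (τ * v (2 ℕ.+ n)))
          ≈⟨ +-congˡ (solve 3 (λ t b v → t :* (b :* (t :* v)) := (t :* t) :* (b :* v)) refl _ _ _) ⟩
        f n + (τ * τ) * (b * v (2 ℕ.+ n))
          ≈⟨ +-congˡ (trans (*-congʳ (σ²≈1 (suc r))) (*-identityˡ _)) ⟩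
        f n + b * v (2 ℕ.+ n) ∎
        where
        b = α (suc n) 1
        p+n : p ℕ.+ suc n ≡ r
        p+n = ℕₚ.suc-injective eq
        τ≈ : σ p ≈ τ
        τ≈ = σ-parity p (suc r) (≡.sym (≡.trans (≡.cong (λ r → not (parity r)) (≡.sym p+n))
          (≡.trans (≡.cong not (parity-+suc p n)) (≡.trans (Boolₚ.not-involutive _)
            (≡.trans (parity-+ p n) (≡.trans (≡.cong (parity p xor_) even) (Boolₚ.xor-identityʳ
                (parity p))))))))

-- The given array, and the effect of one block N_1 ⋯ N_r on a column.

≤⇒≤ᵇ-true : ∀ {m n} → m ≤ n → (m ≤ᵇ n) ≡ true
≤⇒≤ᵇ-true {m} {n} m≤n with m ≤ᵇ n | ℕₚ.≤⇒≤ᵇ m≤n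
... | true | _ = ≡.refl

≰⇒≤ᵇ-false : ∀ {m n} → ¬ m ≤ n → (m ≤ᵇ n) ≡ false
≰⇒≤ᵇ-false {m} {n} m≰n with m ≤ᵇ n in eq
... | true  = ⊥-elim (m≰n (ℕₚ.≤ᵇ⇒≤ m n (≡.subst T (≡.sym eq) tt)))
... | false = ≡.refl

true≢false : true ≢ false
true≢false ()

module Array {c ℓ : Level} (F : Field c ℓ) (r : ℕ) (a : ℕ → Field.Carrier F)
  (α≉0 : ∀ p m → p ≤ suc r → m ≤ suc r → ¬ (Field._≈_ F (arr F r a p m) (Field.0# F)))
  where
  open Field F
  open FieldLemmas F
  open Action F
  open import Relation.Binary.Reasoning.Setoid setoid
  open import Algebra.Solver.Ring.NaturalCoefficients.Default commutativeSemiring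

  α : ℕ → ℕ → Carrier
  α = arr F r a

  α-left : ∀ m → α 0 m ≈ 1#
  α-left zero          = refl
  α-left (suc zero)    = refl
  α-left (suc (suc m)) = refl

  α-right : ∀ m → α (suc r) m ≈ 1#
  α-right zero          = refl
  α-right (suc zero)    rewrite ≤⇒≤ᵇ-true (ℕₚ.≤-refl {suc r}) = refl
  α-right (suc (suc m)) rewrite ≤⇒≤ᵇ-true (ℕₚ.≤-refl {suc r}) = refl

  boundary-interior : ∀ {p} → p < r → boundary F r (suc p) ≡ false
  boundary-interior p<r = ≰⇒≤ᵇ-false (λ r<p → ℕₚ.<⇒≱ p<r (ℕₚ.≤-pred r<p))

  α-first : ∀ p → p < r → α (suc p) 1 ≈ a (suc p)
  α-first p p<r rewrite boundary-interior p<r = refl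

  -- The quotient in `rows` is cleared by multiplying with its nonzero denominator.
  α-rec : Recurrence r α
  α-rec p m p<r m<r = trans (+-congʳ (trans (*-congʳ next) lemma)) (-‿inverseˡ _)
    where
    open import Algebra.Properties.Ring ring using (-‿distribˡ-*)
    x = α p (suc m) * α (2 ℕ.+ p) (suc m)
    next : α (suc p) (2 ℕ.+ m) ≈ - (x * α (suc p) m ⁻¹)
    next rewrite boundary-interior p<r = refl
    lemma : - (x * α (suc p) m ⁻¹) * α (suc p) m ≈ - x
    lemma = trans (sym (-‿distribˡ-* _ _))
      (-‿cong (*⁻¹*-cancel x (α≉0 _ _ (ℕₚ.m≤n⇒m≤1+n p<r) (ℕₚ.m≤n⇒m≤1+n (ℕₚ.<⇒≤ m<r)))))

  open Dynamics F r α α≉0 α-left α-right (λ _ → refl) α-rec public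

  row : ℕ → Mat F (suc r)
  row m = prodM F (map (λ t → N F r a (suc t) m) (upTo r))

  module Row (m : ℕ) (m≤r : m ≤ r) (w : Seq) (w-left : w 0 ≈ 0#) (w-right : w (2 ℕ.+ r) ≈ 0#) where

    -- The entries in position suc k after V_{k+1}, and after U_k V_{k+1}.
    half full : ℕ → Carrier
    half k = (_/_ F (α (suc k) (suc m)) (α (suc k) m)) * w (suc k) + (_/_ F (α k m) (α (suc k) m)) * w (2 ℕ.+ k)
    full k = (_/_ F (α (suc k) (suc m)) (α k m)) * w k + (_/_ F (α k (suc m)) (α k m)) * half k

    -- st is the sequence obtained from w by N_{i+1,-m} ⋯ N_{r,-m}.
    record Partial (i : ℕ) (st : Seq) : Set ℓ where
      field
        same : ∀ p → parity (p ℕ.+ m) ≡ true → st p ≈ w p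
        low  : ∀ p → p ≤ i → st p ≈ w p
        mid  : parity (suc i ℕ.+ m) ≡ false → st (suc i) ≈ half i
        high : ∀ k → i < k → k ≤ r → parity (suc k ℕ.+ m) ≡ false → st (suc k) ≈ full k

    -- There is no V_(r+1), yet `half r` is already w (r+1): its first weight is 1 and its second
    -- term meets the padding.
    initial : Partial r w
    initial = record
      { same = λ _ _ → refl
      ; low  = λ _ _ → refl
      ; mid  = λ _ → sym (begin
          _ * w (suc r) + _ * w (2 ℕ.+ r) ≈⟨ +-cong (*-congʳ (trans (*⁻¹-identityʳ _ (α-right m)) (α-right
              (suc m)))) (*-congˡ w-right) ⟩
          1# * w (suc r) + _ * 0#         ≈⟨ +-cong (*-identityˡ _) (zeroʳ _) ⟩
          w (suc r) + 0#                  ≈⟨ +-identityʳ _ ⟩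
          w (suc r)                       ∎)
      ; high = λ k r<k k≤r _ → ⊥-elim (ℕₚ.<⇒≱ r<k k≤r)
      }

    -- U_(i+1) writes position i + 2, which V_(i+2) has just set to `half`; its other input, at i +
    -- 1, is still that of w.
    add-U : ∀ i st st′ → parity (suc i ℕ.+ m) ≡ true →
      (∀ p → st′ p ≈ stepU (suc i) (_/_ F (α (2 ℕ.+ i) (suc m)) (α (suc i) m)) (_/_ F (α (suc i) (suc m)) (α
          (suc i) m)) st p) →
      Partial (suc i) st → Partial i st′
    add-U i st st′ odd st′≈ P = record
      { same = λ p p-odd → trans (away p (λ { ≡.refl → true≢false (≡.trans (≡.sym p-odd)
          (≡.cong not odd)) })) (same p p-odd)
      ; low  = λ p p≤i → trans (away p (λ { ≡.refl → ℕₚ.<⇒≱ (ℕₚ.n≤1+n (suc i)) p≤i })) (low p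
          (ℕₚ.m≤n⇒m≤1+n p≤i))
      ; mid  = λ even → ⊥-elim (true≢false (≡.trans (≡.sym odd) even))
      ; high = high′
      }
      where
      open Partial P
      x = _/_ F (α (2 ℕ.+ i) (suc m)) (α (suc i) m)
      y = _/_ F (α (suc i) (suc m)) (α (suc i) m)
      away : ∀ p → p ≢ 2 ℕ.+ i → st′ p ≈ st p
      away p p≢ = trans (st′≈ p) (reflexive (≡.cong (λ b → if b then x * st (suc i) + y * st
          (2 ℕ.+ i) else st p) (≢⇒≡ᵇ p≢)))
      high′ : ∀ k → i < k → k ≤ r → parity (suc k ℕ.+ m) ≡ false → st′ (suc k) ≈ full k
      high′ k i<k k≤r even with k ℕ.≟ suc i
      ... | no k≢ = trans (away (suc k) (λ e → k≢ (ℕₚ.suc-injective e))) (high k (ℕₚ.≤∧≢⇒< i<k (λ e → k≢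
          (≡.sym e))) k≤r even)
      ... | yes ≡.refl = trans (st′≈ (2 ℕ.+ i)) (trans
              (reflexive (≡.cong (λ b → if b then x * st (suc i) + y * st (2 ℕ.+ i) else st (2 ℕ.+ i))
                  (≡ᵇ-refl (2 ℕ.+ i))))
              (+-cong (*-congˡ (low (suc i) ℕₚ.≤-refl)) (*-congˡ (mid even))))

    -- V_(i+1) writes position i + 1; its right neighbour i + 2 has the parity that the block never
    -- changes, so both inputs are those of w.
    add-V : ∀ i st st′ → parity (suc i ℕ.+ m) ≡ false →
      (∀ p → st′ p ≈ stepV (suc i) (_/_ F (α (suc i) (suc m)) (α (suc i) m)) (_/_ F (α i m) (α
          (suc i) m)) st p) →
      Partial (suc i) st → Partial i st′
    add-V i st st′ even st′≈ P = record
      { same = λ p p-odd → trans (away p (λ { ≡.refl → true≢false (≡.trans (≡.sym p-odd) even) }))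
          (same p p-odd)
      ; low  = λ p p≤i → trans (away p (λ { ≡.refl → ℕₚ.<⇒≱ (ℕₚ.n<1+n i) p≤i })) (low p (ℕₚ.m≤n⇒m≤1+n p≤i))
      ; mid  = λ _ → trans (st′≈ (suc i)) (trans
                 (reflexive (≡.cong (λ b → if b then x * st (suc i) + y * st (2 ℕ.+ i) else st (suc i))
                     (≡ᵇ-refl (suc i))))
                 (+-cong (*-congˡ (low (suc i) ℕₚ.≤-refl)) (*-congˡ (same (2 ℕ.+ i) (≡.cong not even)))))
      ; high = λ k i<k k≤r k-even → trans (away (suc k) (λ e → ℕₚ.<⇒≢ i<k (≡.sym (ℕₚ.suc-injective e))))
                 (high k (ℕₚ.≤∧≢⇒< i<k (λ { ≡.refl → true≢false (≡.trans (≡.sym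
                     (≡.cong not even)) k-even) })) k≤r k-even)
      }
      where
      open Partial P
      x = _/_ F (α (suc i) (suc m)) (α (suc i) m)
      y = _/_ F (α i m) (α (suc i) m)
      away : ∀ p → p ≢ suc i → st′ p ≈ st p
      away p p≢ = trans (st′≈ p) (reflexive (≡.cong (λ b → if b then x * st (suc i) + y * st
          (2 ℕ.+ i) else st p) (≢⇒≡ᵇ p≢)))

    -- The numerator `α k m` contributed by V cancels against the denominator contributed by U.
    full≈ : ∀ k → k ≤ r → full k ≈ lam k m * w k + (lam k m * rho k m * w (suc k) + rho k m * w (2 ℕ.+ k))
    full≈ k k≤r = trans
      (solve 8 (λ A B′ C D′ w₀ w₁ w₂ B → (A :* B′) :* w₀ :+ (C :* B′) :* ((A :* D′) :* w₁ :+ (B :* D′) :* w₂)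
        := (A :* B′) :* w₀ :+ ((A :* B′) :* (C :* D′) :* w₁ :+ (C :* D′) :*
            ((B :* B′) :* w₂))) refl _ _ _ _ _ _ _ _)
      (+-congˡ (+-congˡ (*-congˡ (trans (*-congʳ (⁻¹-inverse _ (α≉0 _ _ (ℕₚ.m≤n⇒m≤1+n k≤r)
          (ℕₚ.m≤n⇒m≤1+n m≤r)))) (*-identityˡ _)))))

    -- A formal U_0 would act trivially, since w 0 = 0 and `α 0` is constantly 1; so position 1
    -- obeys the general formula.
    half≈full : half 0 ≈ full 0
    half≈full = sym (trans (+-cong (trans (*-congˡ w-left) (zeroʳ _))
      (trans (*-congʳ (trans (*⁻¹-identityʳ _ (α-left m)) (α-left (suc m)))) (*-identityˡ _))) (+-identityˡ _))

    update : ∀ st → Partial 0 st → ∀ p → p ≤ r → parity (suc p ℕ.+ m) ≡ false →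
      st (suc p) ≈ lam p m * w p + (lam p m * rho p m * w (suc p) + rho p m * w (2 ℕ.+ p))
    update st P zero    _   even = trans (Partial.mid P even) (trans half≈full (full≈ 0 z≤n))
    update st P (suc p) p≤r even = trans (Partial.high P (suc p) (s≤s z≤n) p≤r even) (full≈ (suc p) p≤r)

  -- Induction on the number of factors, peeling from the left. `g` stands for the shifted index
  -- functions that unfolding `upTo` produces.
  row-partial : ∀ m (m≤r : m ≤ r) (u : Fin (suc r) → Carrier) n i (g : ℕ → ℕ) →
      (∀ t → g t ≡ i ℕ.+ t) → i ℕ.+ n ≡ r →
    Row.Partial m m≤r (pad u) refl (pad-> u (2 ℕ.+ r) ℕₚ.≤-refl) i
      (pad (foldr _▹_ u (map (λ t → N F r a (suc t) m) (applyUpTo g n))))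
  row-partial m m≤r u zero i g g≡ i≡r with ≡.trans (≡.sym (ℕₚ.+-identityʳ i)) i≡r
  ... | ≡.refl = initial
    where open Row m m≤r (pad u) refl (pad-> u (2 ℕ.+ r) ℕₚ.≤-refl)
  row-partial m m≤r u (suc n) i g g≡ i+n≡r
    rewrite ≡.trans (g≡ 0) (ℕₚ.+-identityʳ i)
    with parity (suc i ℕ.+ m) in eq
       | row-partial m m≤r u n (suc i) (λ t → g (suc t)) (λ t → ≡.trans (g≡ (suc t)) (ℕₚ.+-suc i t))
           (≡.trans (≡.sym (ℕₚ.+-suc i n)) i+n≡r)
  ... | true  | P = add-U i _ _ eq (pad-U r (suc i) _ _ _ _ i<r) P
    where
    open Row m m≤r (pad u) refl (pad-> u (2 ℕ.+ r) ℕₚ.≤-refl)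
    i<r : suc i ≤ r
    i<r = ℕₚ.m+n≤o⇒m≤o (suc i) (ℕₚ.≤-reflexive (≡.trans (≡.sym (ℕₚ.+-suc i n)) i+n≡r))
  ... | false | P = add-V i _ _ eq (pad-V r i _ _ _ _ (ℕₚ.<⇒≤ i<r)) P
    where
    open Row m m≤r (pad u) refl (pad-> u (2 ℕ.+ r) ℕₚ.≤-refl)
    i<r : suc i ≤ r
    i<r = ℕₚ.m+n≤o⇒m≤o (suc i) (ℕₚ.≤-reflexive (≡.trans (≡.sym (ℕₚ.+-suc i n)) i+n≡r))

  module Column (j : Fin (suc r)) where

    -- Column j of the product of the blocks k - 1, ..., 0; the rightmost block acts first, and
    -- `column 0` is the j-th unit vector.
    column : ℕ → Fin (suc r) → Carrier
    column k i = prodM F (map row (downFrom k)) i j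

    W : ℕ → Seq
    W k = pad (column k)

    W-suc : ∀ m p → W (suc m) p ≈ pad (foldr _▹_ (column m) (map (λ t → N F r a (suc t) m) (upTo r))) p
    -- By the definition of the matrix product, `column (suc m)` is `row m` applied to `column m`.
    W-suc m = pad-cong (prodM-▹ (map (λ t → N F r a (suc t) m) (upTo r)) (column m))

    W-update : ∀ p m → p ≤ r → m ≤ r → parity (suc p ℕ.+ m) ≡ false →
      W (suc m) (suc p) ≈ lam p m * W m p + (lam p m * rho p m * W m (suc p) + rho p m * W m (2 ℕ.+ p))
    W-update p m p≤r m≤r even = trans (W-suc m (suc p))
      (Row.update m m≤r (W m) refl _ _ (row-partial m m≤r (column m) r 0 (λ t → t)
          (λ _ → ≡.refl) ≡.refl) p p≤r even)

    W-stay : ∀ p m → m ≤ r → parity (p ℕ.+ m) ≡ true → W (suc m) p ≈ W m p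
    W-stay p m m≤r odd = trans (W-suc m p)
      (Row.Partial.same (row-partial m m≤r (column m) r 0 (λ t → t) (λ _ → ≡.refl) ≡.refl) p odd)

    open Flow W (λ _ → refl) (λ m → pad-> (column m) (2 ℕ.+ r) ℕₚ.≤-refl) W-update W-stay public

-- Products of commuting shears, and the antidiagonal matrix `Pmat`.

≡ᵇ-cancelˡ : ∀ p m n → (p ℕ.+ m ≡ᵇ p ℕ.+ n) ≡ (m ≡ᵇ n)
≡ᵇ-cancelˡ zero    m n = ≡.refl
≡ᵇ-cancelˡ (suc p) m n = ≡ᵇ-cancelˡ p m n

module Shears {c ℓ : Level} (F : Field c ℓ) (r : ℕ) where
  open Field F
  open FieldLemmas F
  open Action F
  open import Relation.Binary.Reasoning.Setoid setoid
  open import Algebra.Solver.Ring.NaturalCoefficients.Default commutativeSemiring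

  shear : ℕ → Carrier → Mat F (suc r)
  shear i x = U F r i 1# 1# x

  -- Written as an added term, so that the contributions of two shears can be exchanged by
  -- commutativity of addition.
  pad-shear : ∀ i x u → i ≤ r → ∀ p → pad (shear i x ▹ u) p ≈ δ (suc i) (x * pad u i) p + pad u p
  pad-shear i x u i≤r p = trans (pad-U r i 1# 1# x u i≤r p) lemma
    where
    lemma : stepU i (_/_ F x 1#) (_/_ F 1# 1#) (pad u) p ≈ δ (suc i) (x * pad u i) p + pad u p
    lemma with p ≡ᵇ suc i in eq
    ... | false = sym (+-identityˡ _)
    ... | true  rewrite ≡ᵇ-true {p} eq = +-cong (*-congʳ (*⁻¹-identityʳ x refl)) (trans (*-congʳ
        (*⁻¹-identityʳ 1# refl)) (*-identityˡ _))

  shear-hit : ∀ i x u → i ≤ r → pad (shear i x ▹ u) (suc i) ≈ x * pad u i + pad u (suc i)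
  shear-hit i x u i≤r = trans (pad-shear i x u i≤r (suc i))
    (+-congʳ (reflexive (≡.cong (λ b → if b then x * pad u i else 0#) (≡ᵇ-refl i))))

  shear-miss : ∀ i x u → i ≤ r → ∀ p → p ≢ suc i → pad (shear i x ▹ u) p ≈ pad u p
  shear-miss i x u i≤r p p≢ = trans (pad-shear i x u i≤r p)
    (trans (+-congʳ (reflexive (≡.cong (λ b → if b then x * pad u i else 0#) (≢⇒≡ᵇ p≢)))) (+-identityˡ _))

  ▹-Id : ∀ (A : Mat F (suc r)) p q → A p q ≈ (A ▹ (λ k → Id F k q)) p
  ▹-Id A p q = sym (begin
    ∑ F (λ k → A p k * Id F k q)                        ≈⟨ ∑-cong (suc r) (λ k → *-comm (A p k) (Id F k q)) ⟩
    ∑ F (λ k → δ (suc (toℕ q)) 1# (suc (toℕ k)) * A p k) ≈⟨ ∑-δ (suc r) (suc (toℕ q)) 1# (A p) ⟩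
    1# * at (A p) (toℕ q)                               ≈⟨ trans (*-identityˡ _) (reflexive (at-toℕ (A p) q)) ⟩
    A p q                                               ∎)

  -- A shear with index i reads position i and writes position i + 1; the two inequalities say that
  -- neither shear reads what the other writes.
  shears-commute-on : ∀ i j x y u → i ≤ r → j ≤ r → i ≢ suc j → j ≢ suc i →
    ∀ p → pad (shear i x ▹ shear j y ▹ u) p ≈ pad (shear j y ▹ shear i x ▹ u) p
  shears-commute-on i j x y u i≤r j≤r i≢ j≢ p = begin
    pad (shear i x ▹ shear j y ▹ u) p
      ≈⟨ pad-shear i x _ i≤r p ⟩
    δ (suc i) (x * pad (shear j y ▹ u) i) p + pad (shear j y ▹ u) p
      ≈⟨ +-cong (δ-cong (suc i) (*-congˡ (shear-miss j y u j≤r i i≢))) (pad-shear j y u j≤r p) ⟩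
    δ (suc i) (x * pad u i) p + (δ (suc j) (y * pad u j) p + pad u p)
      ≈⟨ solve 3 (λ a b d → a :+ (b :+ d) := b :+ (a :+ d)) refl _ _ _ ⟩
    δ (suc j) (y * pad u j) p + (δ (suc i) (x * pad u i) p + pad u p)
      ≈⟨ sym (+-cong (δ-cong (suc j) (*-congˡ (shear-miss i x u i≤r j j≢))) (pad-shear i x u i≤r p)) ⟩
    δ (suc j) (y * pad (shear i x ▹ u) j) p + pad (shear i x ▹ u) p
      ≈⟨ sym (pad-shear j y _ j≤r p) ⟩
    pad (shear j y ▹ shear i x ▹ u) p ∎
    where
    δ-cong : ∀ k {x y} → x ≈ y → δ k x p ≈ δ k y p
    δ-cong k x≈y with p ≡ᵇ k
    ... | true  = x≈y
    ... | false = refl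

  shears-commute : ∀ i j x y → i ≤ r → j ≤ r → i ≢ suc j → j ≢ suc i →
    _≋_ F (_·_ F (shear i x) (shear j y)) (_·_ F (shear j y) (shear i x))
  shears-commute i j x y i≤r j≤r i≢ j≢ p q = begin
    (shear i x ▹ (λ k → shear j y k q)) p ≈⟨ ▹-cong (shear i x) (λ k → ▹-Id (shear j y) k q) p ⟩
    (shear i x ▹ shear j y ▹ u) p         ≈⟨ pad-toℕ _ p ⟩
    pad (shear i x ▹ shear j y ▹ u) (suc (toℕ p)) ≈⟨ shears-commute-on i j x y u i≤r j≤r i≢ j≢ (suc (toℕ p)) ⟩
    pad (shear j y ▹ shear i x ▹ u) (suc (toℕ p)) ≈⟨ sym (pad-toℕ _ p) ⟩
    (shear j y ▹ shear i x ▹ u) p         ≈⟨ ▹-cong (shear j y) (λ k → sym (▹-Id (shear i x) k q)) p ⟩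
    (shear j y ▹ (λ k → shear i x k q)) p ∎
    where
    u : Fin (suc r) → Carrier
    u k = Id F k q

  -- Indices in steps of two; h i = 2i + ε gives the left product of the theorem and h i = 2i the
  -- right one.
  module Family (h : ℕ → ℕ) (h-suc : ∀ i → h (suc i) ≡ 2 ℕ.+ h i) (x : ℕ → Carrier) where

    parity-h : ∀ i → parity (h i) ≡ parity (h 0)
    parity-h zero    = ≡.refl
    parity-h (suc i) = ≡.trans (≡.cong parity (h-suc i)) (≡.trans (Boolₚ.not-involutive _) (parity-h i))

    h-mono : ∀ {i j} → i ≤ j → h i ≤ h j
    h-mono {j = zero}  z≤n = ℕₚ.≤-refl
    h-mono {i} {suc j} i≤j with i ℕ.≟ suc j
    ... | yes ≡.refl = ℕₚ.≤-refl
    ... | no i≢ = ℕₚ.≤-trans (h-mono (ℕₚ.≤-pred (ℕₚ.≤∧≢⇒< i≤j i≢)))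
            (ℕₚ.≤-trans (ℕₚ.m≤n+m _ 2) (ℕₚ.≤-reflexive (≡.sym (h-suc j))))

    h-≢ : ∀ i j → h i ≢ suc (h j)
    h-≢ i j eq with parity (h i) | parity-h i | parity (h j) | parity-h j | ≡.cong parity eq
    ... | _ | ≡.refl | _ | ≡.refl | e = Boolₚ.not-¬ ≡.refl e

    factor : ℕ → Mat F (suc r)
    factor i = shear (h i) (x i)

    commute : ∀ o n → (∀ t → t < n → h (o ℕ.+ t) ≤ r) → PairwiseCommute F (map factor (map (o ℕ.+_) (upTo n)))
    commute o n h≤ X∈ Y∈ with ∈-map⁻ factor X∈ | ∈-map⁻ factor Y∈
    ... | i , i∈ , ≡.refl | j , j∈ , ≡.refl = shears-commute (h i) (h j) _ _ (bound i∈) (bound j∈) (h-≢ i j)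
        (h-≢ j i)
      where
      bound : ∀ {k} → k ∈ map (o ℕ.+_) (upTo n) → h k ≤ r
      bound k∈ with ∈-map⁻ (o ℕ.+_) k∈
      ... | t , t∈ , ≡.refl = h≤ t (∈-upTo⁻ t∈)

    -- The factors are o, ..., o + n - 1. They read positions of the parity of h 0 and write only
    -- the others, so every written entry is a formula in the original w.
    record Product (o n : ℕ) (w st : Seq) : Set ℓ where
      field
        fixed : ∀ p → parity p ≡ parity (h 0) → st p ≈ w p
        low   : ∀ p → p ≤ h o → st p ≈ w p
        hit   : ∀ i → o ≤ i → i < o ℕ.+ n → st (suc (h i)) ≈ x i * w (h i) + w (suc (h i))

    product : ∀ n o (g : ℕ → ℕ) → (∀ t → g t ≡ o ℕ.+ t) → (∀ t → t < n → h (o ℕ.+ t) ≤ r) → ∀ u →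
      Product o n (pad u) (pad (foldr _▹_ u (map factor (applyUpTo g n))))
    product zero    o g g≡ h≤ u = record
      { fixed = λ _ _ → refl
      ; low   = λ _ _ → refl
      ; hit   = λ i o≤i i<o → ⊥-elim (ℕₚ.<⇒≱ i<o (ℕₚ.≤-trans (ℕₚ.≤-reflexive (ℕₚ.+-identityʳ o)) o≤i))
      }
    product (suc n) o g g≡ h≤ u rewrite ≡.trans (g≡ 0) (ℕₚ.+-identityʳ o) = record
      { fixed = λ p p≡ → trans (miss p (λ { ≡.refl → Boolₚ.not-¬ (≡.sym (parity-h o)) (≡.sym p≡) }))
          (fixed p p≡)
      ; low   = λ p p≤ → trans (miss p (λ { ≡.refl → ℕₚ.1+n≰n p≤ })) (low p (ℕₚ.≤-trans p≤ (h-mono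
          (ℕₚ.n≤1+n o))))
      ; hit   = hit′
      }
      where
      rest = foldr _▹_ u (map factor (applyUpTo (λ t → g (suc t)) n))
      open Product (product n (suc o) (λ t → g (suc t)) (λ t → ≡.trans (g≡ (suc t)) (ℕₚ.+-suc o t))
        (λ t t<n → ≡.subst (λ k → h k ≤ r) (ℕₚ.+-suc o t) (h≤ (suc t) (s≤s t<n))) u)
      ho≤r : h o ≤ r
      ho≤r = ≡.subst (λ k → h k ≤ r) (ℕₚ.+-identityʳ o) (h≤ 0 (s≤s z≤n))
      miss : ∀ p → p ≢ suc (h o) → pad (factor o ▹ rest) p ≈ pad rest p
      miss = shear-miss (h o) (x o) rest ho≤r
      ho< : suc (h o) ≤ h (suc o)
      ho< = ℕₚ.≤-trans (ℕₚ.n≤1+n _) (ℕₚ.≤-reflexive (≡.sym (h-suc o)))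
      hit′ : ∀ i → o ≤ i → i < o ℕ.+ suc n → pad (factor o ▹ rest) (suc (h i)) ≈ x i * pad u (h i) + pad u
          (suc (h i))
      hit′ i o≤i i< with i ℕ.≟ o
      -- The later factors write only above position h (o + 1), hence leave both inputs of factor o
      -- intact.
      ... | yes ≡.refl = trans (shear-hit (h i) (x i) rest ho≤r)
              (+-cong (*-congˡ (low (h i) (ℕₚ.<⇒≤ ho<))) (low (suc (h i)) ho<))
      ... | no i≢o = trans (miss (suc (h i)) (λ e → ℕₚ.<⇒≢ (ℕₚ.≤-trans ho< (h-mono o<i)) (≡.sym
          (ℕₚ.suc-injective e))))
              (hit i o<i (ℕₚ.≤-trans i< (ℕₚ.≤-reflexive (ℕₚ.+-suc o n))))
        where
        o<i : o < i
        o<i = ℕₚ.≤∧≢⇒< o≤i (λ e → i≢o (≡.sym e))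

  pad-Pmat : ∀ (u : Fin (suc r) → Carrier) k q → suc k ℕ.+ q ≡ 2 ℕ.+ r →
    k ≤ r → pad (Pmat F r ▹ u) (suc k) ≈ σ ((r ∸ 1) ℕ.* k) * pad u q
  pad-Pmat u k q k+q k≤r = ≡.subst (λ k → pad (Pmat F r ▹ u) (suc k) ≈ σ ((r ∸ 1) ℕ.* k) * pad u q)
    (Finₚ.toℕ-fromℕ< (s≤s k≤r)) (trans (sym (pad-toℕ (Pmat F r ▹ u) p)) (begin
      ∑ F (λ l → Pmat F r p l * u l)
        ≈⟨ ∑-cong (suc r) (λ l → *-congʳ {u l} (reflexive (≡.cong (λ b → if b then s else 0#) (index (suc
            (toℕ l)))))) ⟩
      ∑ F (λ l → δ q s (suc (toℕ l)) * u l)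
        ≈⟨ ∑-δ (suc r) q s u ⟩
      s * pad u q ∎))
    where
    p = Fin.fromℕ< (s≤s k≤r)
    s = σ ((r ∸ 1) ℕ.* toℕ p)
    -- Row k + 1 of `Pmat` has its only entry in column q = r + 1 - k.
    index : ∀ l → (suc (toℕ p) ℕ.+ l ≡ᵇ r ℕ.+ 2) ≡ (l ≡ᵇ q)
    index l = ≡.trans (≡.cong (suc (toℕ p) ℕ.+ l ≡ᵇ_)
      (≡.trans (ℕₚ.+-comm r 2) (≡.trans (≡.sym k+q) (≡.cong (λ k → suc k ℕ.+ q) (≡.sym (Finₚ.toℕ-fromℕ<
          (s≤s k≤r)))))))
      (≡ᵇ-cancelˡ (suc (toℕ p)) l q)

-- The right-hand side applied to a unit vector, and the comparison of both sides.

2*suc : ∀ i → 2 ℕ.* suc i ≡ 2 ℕ.+ 2 ℕ.* i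
2*suc i = ≡.cong suc (ℕₚ.+-suc i (i ℕ.+ 0))

-- Translates the position k = r - 2i into the index s - i of the left product.
complement-of-even : ∀ k i s ε → ε ≤ 1 → k ℕ.+ 2 ℕ.* i ≡ 2 ℕ.* s ℕ.+ ε → i ≤ s × k ≡ 2 ℕ.* (s ∸ i) ℕ.+ ε
complement-of-even k i s ε ε≤1 eq = i≤s , ℕₚ.+-cancelʳ-≡ (2 ℕ.* i) k _ (begin
  k ℕ.+ 2 ℕ.* i                           ≡⟨ eq ⟩
  2 ℕ.* s ℕ.+ ε                           ≡⟨ ≡.cong (λ t → 2 ℕ.* t ℕ.+ ε) (≡.sym (ℕₚ.m∸n+n≡m i≤s)) ⟩
  2 ℕ.* (s ∸ i ℕ.+ i) ℕ.+ ε               ≡⟨ ≡.cong (ℕ._+ ε) (ℕₚ.*-distribˡ-+ 2 (s ∸ i) i) ⟩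
  2 ℕ.* (s ∸ i) ℕ.+ 2 ℕ.* i ℕ.+ ε         ≡⟨ ℕₚ.+-assoc (2 ℕ.* (s ∸ i)) (2 ℕ.* i) ε ⟩
  2 ℕ.* (s ∸ i) ℕ.+ (2 ℕ.* i ℕ.+ ε)       ≡⟨ ≡.cong (2 ℕ.* (s ∸ i) ℕ.+_) (ℕₚ.+-comm (2 ℕ.* i) ε) ⟩
  2 ℕ.* (s ∸ i) ℕ.+ (ε ℕ.+ 2 ℕ.* i)       ≡⟨ ≡.sym (ℕₚ.+-assoc (2 ℕ.* (s ∸ i)) ε (2 ℕ.* i)) ⟩
  2 ℕ.* (s ∸ i) ℕ.+ ε ℕ.+ 2 ℕ.* i         ∎)
  where
  open ≡.≡-Reasoning
  i≤s : i ≤ s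
  i≤s = ℕₚ.≮⇒≥ (λ s<i → ℕₚ.<-irrefl ≡.refl (ℕₚ.≤-trans
    (ℕₚ.≤-trans (ℕₚ.≤-reflexive (≡.sym (2*suc s))) (ℕₚ.≤-trans (ℕₚ.*-monoʳ-≤ 2 s<i) (ℕₚ.m+n≤o⇒n≤o k
        (ℕₚ.≤-reflexive eq))))
    (ℕₚ.≤-trans (ℕₚ.+-monoʳ-≤ (2 ℕ.* s) ε≤1) (ℕₚ.≤-reflexive (ℕₚ.+-comm (2 ℕ.* s) 1)))))

module Factorisation {c ℓ : Level} (F : Field c ℓ) (r s ε : ℕ) (1≤r : 1 ≤ r) (ε≤1 : ε ≤ 1)
  (r≡ : r ≡ 2 ℕ.* s ℕ.+ ε) (a : ℕ → Field.Carrier F)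
  (α≉0 : ∀ p m → p ≤ suc r → m ≤ suc r → ¬ (Field._≈_ F (arr F r a p m) (Field.0# F)))
  where
  open Field F
  open FieldLemmas F
  open Action F
  open Shears F r
  open Array F r a α≉0
  open import Relation.Binary.Reasoning.Setoid setoid

  module L = Family (λ i → 2 ℕ.* i ℕ.+ ε) (λ i → ≡.cong (ℕ._+ ε) (2*suc i)) (λ i → σ (ε ℕ.+ 1) * a (2 ℕ.*
      (s ∸ i) ℕ.+ 1))
  module R = Family (2 ℕ.*_) 2*suc (λ i → a (2 ℕ.* i))

  even⇒2* : ∀ n → parity n ≡ false → ∃ λ i → n ≡ 2 ℕ.* i
  even⇒2* zero          _    = 0 , ≡.refl
  even⇒2* (suc (suc n)) even with even⇒2* n (≡.trans (≡.sym (Boolₚ.not-involutive _)) even)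
  ... | i , ≡.refl = suc i , ≡.sym (2*suc i)

  L-bound : ∀ t → t < s ℕ.+ ε → 2 ℕ.* (1 ∸ ε ℕ.+ t) ℕ.+ ε ≤ r
  L-bound t t< = ℕₚ.≤-trans (ℕₚ.+-monoˡ-≤ ε (ℕₚ.*-monoʳ-≤ 2 (bound ε ε≤1 t<))) (ℕₚ.≤-reflexive (≡.sym r≡))
    where
    bound : ∀ ε → ε ≤ 1 → t < s ℕ.+ ε → 1 ∸ ε ℕ.+ t ≤ s
    bound zero       _         t< = ℕₚ.≤-trans t< (ℕₚ.≤-reflexive (ℕₚ.+-identityʳ s))
    bound (suc zero) (s≤s z≤n) t< = ℕₚ.≤-pred (ℕₚ.≤-trans t< (ℕₚ.≤-reflexive (ℕₚ.+-comm s 1)))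

  2*≤r : ∀ {i} → i ≤ s → 2 ℕ.* i ≤ r
  2*≤r i≤s = ℕₚ.≤-trans (ℕₚ.*-monoʳ-≤ 2 i≤s) (ℕₚ.≤-trans (ℕₚ.m≤m+n _ ε) (ℕₚ.≤-reflexive (≡.sym r≡)))

  left-commute : PairwiseCommute F (leftFactors F r s ε a)
  left-commute = L.commute (1 ∸ ε) (s ℕ.+ ε) L-bound

  right-commute : PairwiseCommute F (rightFactors F r s a)
  right-commute = R.commute 1 s (λ _ → 2*≤r)

  parity-r : parity r ≡ parity ε
  parity-r = ≡.trans (≡.cong parity r≡) (≡.trans (parity-+ (2 ℕ.* s) ε) (≡.cong (_xor parity ε) (parity-* 2 s)))

  parity-r-1 : not (parity (r ∸ 1)) ≡ parity r
  parity-r-1 = ≡.cong parity (ℕₚ.m+[n∸m]≡n 1≤r)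

  parity-summand : ∀ k n m → k ℕ.+ n ≡ m → parity k ≡ parity m → parity n ≡ false
  parity-summand k n _ ≡.refl eq = lemma (parity k) (parity n) (≡.trans eq (parity-+ k n))
    where
    lemma : ∀ b d → b ≡ b xor d → d ≡ false
    lemma true  false _ = ≡.refl
    lemma false false _ = ≡.refl

  module _ (j : Fin (suc r)) where
    open Column j

    -- The j-th unit vector after the right product, then after `Pmat`, then after the left product.
    y x z : Fin (suc r) → Carrier
    y = foldr _▹_ (column 0) (rightFactors F r s a)
    x = Pmat F r ▹ y
    z = foldr _▹_ x (leftFactors F r s ε a)

    y-product : R.Product 1 s v (pad y)
    y-product = ≡.subst (λ is → R.Product 1 s v (pad (foldr _▹_ (column 0) (map R.factor is))))
      (≡.sym (map-upTo suc s)) (R.product s 1 suc (λ _ → ≡.refl) (λ _ → 2*≤r) (column 0))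

    z-product : L.Product (1 ∸ ε) (s ℕ.+ ε) (pad x) (pad z)
    z-product = ≡.subst (λ is → L.Product (1 ∸ ε) (s ℕ.+ ε) (pad x) (pad (foldr _▹_ x (map L.factor is))))
      (≡.sym (map-upTo (λ t → 1 ∸ ε ℕ.+ t) (s ℕ.+ ε))) (L.product (s ℕ.+ ε) (1 ∸ ε) (1 ∸ ε ℕ.+_)
          (λ _ → ≡.refl) L-bound x)

    y-even : ∀ q → parity q ≡ false → pad y q ≈ v q
    y-even = R.Product.fixed y-product

    -- The shear with index 2i writes this position; at i = 0 there is no shear, and `f 0` is v 1
    -- because v 0 = 0.
    y-odd : ∀ i → i ≤ s → pad y (suc (2 ℕ.* i)) ≈ f (2 ℕ.* i)
    y-odd zero    _   = trans (R.Product.low y-product 1 (s≤s z≤n)) (sym (+-*0ʳ refl))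
    y-odd (suc i) i<s = trans (R.Product.hit y-product (suc i) (s≤s z≤n) (s≤s i<s))
      (trans (+-comm _ _) (+-congˡ (*-congʳ (sym (α-first _ (2*≤r i<s))))))

    -- Here k and r - 1 have equal parity, so (r - 1) k has the parity of r + 1 and the sign of
    -- `Pmat` is τ; in `x-other` this product is even and the sign is 1.
    x-same : ∀ k q → suc k ℕ.+ q ≡ 2 ℕ.+ r → k ≤ r → parity (suc k) ≡ parity r → pad x (suc k) ≈ τ * v q
    x-same k q k+q k≤r same = trans (pad-Pmat y k q k+q k≤r)
      (*-cong (σ-parity ((r ∸ 1) ℕ.* k) (suc r) sign≡) (y-even q
        (parity-summand (suc k) q (2 ℕ.+ r) k+q (≡.trans same (≡.sym (Boolₚ.not-involutive (parity r)))))))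
      where
      k≡r-1 : parity k ≡ parity (r ∸ 1)
      k≡r-1 = Boolₚ.not-injective (≡.trans same (≡.sym parity-r-1))
      sign≡ : parity ((r ∸ 1) ℕ.* k) ≡ parity (suc r)
      sign≡ = ≡.trans (parity-* (r ∸ 1) k) (≡.trans (≡.cong (parity (r ∸ 1) ∧_) k≡r-1)
        (≡.trans (Boolₚ.∧-idem _) (≡.trans (≡.sym (Boolₚ.not-involutive _)) (≡.cong not parity-r-1))))

    x-other : ∀ k n → k ℕ.+ n ≡ r → parity k ≡ parity r → pad x (suc k) ≈ f n
    x-other k n k+n same with even⇒2* n (parity-summand k n r k+n same)
    ... | i , ≡.refl = trans
      (pad-Pmat y k (suc n) (≡.cong suc (≡.trans (ℕₚ.+-suc k n) (≡.cong suc k+n))) (ℕₚ.m+n≤o⇒m≤o k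
          (ℕₚ.≤-reflexive k+n)))
      (trans (*-cong (σ-even ((r ∸ 1) ℕ.* k) sign≡) (y-odd i (proj₁ (complement-of-even k i s ε ε≤1
          (≡.trans k+n r≡)))))
             (*-identityˡ _))
      where
      sign≡ : parity ((r ∸ 1) ℕ.* k) ≡ false
      sign≡ = ≡.trans (parity-* (r ∸ 1) k) (≡.trans (≡.cong (parity (r ∸ 1) ∧_) (≡.trans same
          (≡.sym parity-r-1)))
        (Boolₚ.∧-inverseʳ (parity (r ∸ 1))))

    z-same : ∀ k q → suc k ℕ.+ q ≡ 2 ℕ.+ r → k ≤ r → parity (suc k) ≡ parity r → pad z (suc k) ≈ τ * v q
    z-same k q k+q k≤r same = trans (L.Product.fixed z-product (suc k) (≡.trans same parity-r))
        (x-same k q k+q k≤r same)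

    -- The left shear writing position k + 1 carries the sign τ and reads an entry that already
    -- carries τ; the two cancel. Position 1 is written by no shear.
    z-other : ∀ k n → k ℕ.+ n ≡ r → parity k ≡ parity r → pad z (suc k) ≈ f n + α (suc n) 1 * v (2 ℕ.+ n)
    z-other zero n ≡.refl same = trans (L.Product.low z-product 1 (one≤ ε (≡.trans same parity-r)))
      (trans (x-other 0 n ≡.refl same) (sym (+-*0ʳ (pad-> (column 0) (2 ℕ.+ r) ℕₚ.≤-refl))))
      where
      one≤ : ∀ ε → false ≡ parity ε → 1 ≤ 2 ℕ.* (1 ∸ ε) ℕ.+ ε
      one≤ zero    _ = s≤s z≤n
      one≤ (suc ε) _ = ℕₚ.≤-trans (s≤s z≤n) (ℕₚ.m≤n+m (suc ε) _)
    z-other (suc k) n k+n same with even⇒2* n (parity-summand (suc k) n r k+n same)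
    ... | i , ≡.refl with complement-of-even (suc k) i s ε ε≤1 (≡.trans k+n r≡)
    ... | i≤s , k≡ = begin
      pad z (2 ℕ.+ k)
        ≡⟨ ≡.cong (λ t → pad z (suc t)) k≡ ⟩
      pad z (suc (2 ℕ.* (s ∸ i) ℕ.+ ε))
        ≈⟨ L.Product.hit z-product (s ∸ i) (low ε (s ∸ i) ε≤1 k≡) (high ε ε≤1 (ℕₚ.m∸n≤m s i)) ⟩
      (σ (ε ℕ.+ 1) * a (2 ℕ.* (s ∸ (s ∸ i)) ℕ.+ 1)) * pad x (2 ℕ.* (s ∸ i) ℕ.+ ε) + pad x (suc (2 ℕ.*
          (s ∸ i) ℕ.+ ε))
        ≡⟨ ≡.cong₂ (λ m t → (σ (ε ℕ.+ 1) * a m) * pad x t + pad x (suc t)) index (≡.sym k≡) ⟩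
      (σ (ε ℕ.+ 1) * a (suc n)) * pad x (suc k) + pad x (2 ℕ.+ k)
        ≈⟨ +-cong (*-cong (*-cong σ≈τ (sym (α-first n n<r)))
                     (x-same k (2 ℕ.+ n) (≡.trans (≡.cong suc (≡.trans (ℕₚ.+-suc k (suc n)) (≡.cong suc
                         (ℕₚ.+-suc k n)))) (≡.cong (2 ℕ.+_) k+n)) k≤r same))
             (x-other (suc k) n k+n same) ⟩
      (τ * α (suc n) 1) * (τ * v (2 ℕ.+ n)) + f n
        ≈⟨ solve 4 (λ t b v f → (t :* b) :* (t :* v) :+ f := f :+ (t :* t) :* (b :* v)) refl _ _ _ _ ⟩
      f n + (τ * τ) * (α (suc n) 1 * v (2 ℕ.+ n))
        ≈⟨ +-congˡ (trans (*-congʳ (σ²≈1 (suc r))) (*-identityˡ _)) ⟩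
      f n + α (suc n) 1 * v (2 ℕ.+ n) ∎
      where
      open import Algebra.Solver.Ring.NaturalCoefficients.Default commutativeSemiring
      k≤r : k ≤ r
      k≤r = ℕₚ.m+n≤o⇒m≤o k (ℕₚ.≤-trans (ℕₚ.n≤1+n _) (ℕₚ.≤-reflexive k+n))
      n<r : n < r
      n<r = ℕₚ.≤-trans (s≤s (ℕₚ.m≤n+m n k)) (ℕₚ.≤-reflexive k+n)
      index : 2 ℕ.* (s ∸ (s ∸ i)) ℕ.+ 1 ≡ suc (2 ℕ.* i)
      index = ≡.trans (≡.cong (λ t → 2 ℕ.* t ℕ.+ 1) (ℕₚ.m∸[m∸n]≡n i≤s)) (ℕₚ.+-comm (2 ℕ.* i) 1)
      σ≈τ : σ (ε ℕ.+ 1) ≈ τ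
      σ≈τ = σ-parity (ε ℕ.+ 1) (suc r) (≡.trans (≡.cong parity (ℕₚ.+-comm ε 1)) (≡.cong not (≡.sym parity-r)))
      -- For ε = 0 the index range starts at 1, and t is positive because the position is.
      low : ∀ ε t → ε ≤ 1 → suc k ≡ 2 ℕ.* t ℕ.+ ε → 1 ∸ ε ≤ t
      low zero       (suc t) _ _ = s≤s z≤n
      low (suc zero) t       _ _ = z≤n
      low (suc (suc _)) t (s≤s ()) _
      high : ∀ ε {t} → ε ≤ 1 → t ≤ s → t < 1 ∸ ε ℕ.+ (s ℕ.+ ε)
      high zero       _ t≤s = s≤s (ℕₚ.≤-trans t≤s (ℕₚ.m≤m+n s 0))
      high (suc zero) _ t≤s = ℕₚ.≤-trans (s≤s t≤s) (ℕₚ.≤-reflexive (ℕₚ.+-comm 1 s))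
      high (suc (suc _)) (s≤s ()) _

    -- According to the parity of k, both sides have the same closed form in v.
    W-final : ∀ k → k ≤ r → W (suc r) (suc k) ≈ pad z (suc k)
    W-final k k≤r with parity k Boolₚ.≟ parity r
    ... | yes same = trans
            (final-other k n (≡.trans (ℕₚ.+-suc k n) (≡.cong suc k+n)) (parity-summand k n r k+n same))
            (sym (z-other k n k+n same))
      where
      n = r ∸ k
      k+n : k ℕ.+ n ≡ r
      k+n = ℕₚ.m+[n∸m]≡n k≤r
    ... | no differ = trans
            (final-same (suc k) q k+q (parity-summand (suc k) q (2 ℕ.+ r) k+q (≡.trans same (≡.sym
                (Boolₚ.not-involutive (parity r))))))
            (sym (z-same k q k+q k≤r same))
      where
      q = suc (r ∸ k)
      k+q : suc k ℕ.+ q ≡ 2 ℕ.+ r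
      k+q = ≡.cong suc (≡.trans (ℕₚ.+-suc k (r ∸ k)) (≡.cong suc (ℕₚ.m+[n∸m]≡n k≤r)))
      same : parity (suc k) ≡ parity r
      same = ≡.sym (Boolₚ.¬-not (λ e → differ (≡.sym e)))

    prodM-column : ∀ As i → prodM F As i j ≈ foldr _▹_ (column 0) As i
    prodM-column []       i = refl
    prodM-column (A ∷ As) i = ▹-cong A (prodM-column As) i

    rhs-column : ∀ i → _·_ F (_·_ F (prodM F (leftFactors F r s ε a)) (Pmat F r)) (prodM F
        (rightFactors F r s a)) i j ≈ z i
    rhs-column i = begin
      (_·_ F Lp (Pmat F r) ▹ (λ k → prodM F (rightFactors F r s a) k j)) i ≈⟨ ▹-cong (_·_ F Lp (Pmat F r))
          (prodM-column (rightFactors F r s a)) i ⟩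
      (_·_ F Lp (Pmat F r) ▹ y) i ≈⟨ ·-▹ Lp (Pmat F r) y i ⟩
      (Lp ▹ x) i                  ≈⟨ prodM-▹ (leftFactors F r s ε a) x i ⟩
      z i                         ∎
      where
      Lp = prodM F (leftFactors F r s ε a)

    factorisation : ∀ i → Prr F r a i j ≈ _·_ F (_·_ F (prodM F (leftFactors F r s ε a)) (Pmat F r))
        (prodM F (rightFactors F r s a)) i j
    factorisation i = begin
      column (suc r) i             ≈⟨ pad-toℕ (column (suc r)) i ⟩
      W (suc r) (suc (toℕ i))      ≈⟨ W-final (toℕ i) (ℕₚ.≤-pred (Finₚ.toℕ<n i)) ⟩
      pad z (suc (toℕ i))          ≈⟨ sym (pad-toℕ z i) ⟩
      z i                          ≈⟨ sym (rhs-column i) ⟩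
      _                            ∎

open import Data.Nat using (_+_; _*_)

theorem5p16 : ∀ {c ℓ : Level} (F : Field c ℓ) (r s ε : ℕ) →
    1 ≤ r → ε ≤ 1 → r ≡ 2 * s + ε →
    (a : ℕ → Field.Carrier F) →
    (∀ i j → i ≤ suc r → j ≤ suc r → ¬ (Field._≈_ F (arr F r a i j) (Field.0# F))) →
    _≋_ F (Prr F r a)
    (_·_ F (_·_ F (prodM F (leftFactors F r s ε a)) (Pmat F r))
    (prodM F (rightFactors F r s a)))
    × PairwiseCommute F (leftFactors F r s ε a)
    × PairwiseCommute F (rightFactors F r s a)
theorem5p16 F r s ε 1≤r ε≤1 r≡ a α≉0 = (λ i j → factorisation j i) , left-commute , right-commute
  where open Factorisation F r s ε 1≤r ε≤1 r≡ a α≉0
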